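{- Let $U$ be a unital of order $n \ge 2$, let $G_U$ be its incidence graph, and let $c(n) = n^2 - \frac{\sqrt{8n^2+9}-3}{2}$. Then \[ \frac{2 \left(n^3+1-\lfloor c(n)\rfloor\right)}{n^2(n^2+1)} \le i(G_U) \le \frac{2 \left(n^3+1-\min\{m(U), \lfloor c(n)\rfloor\}\right)}{n^2(n^2+1)}. \]
   Context: A $2$-$(v,k,\lambda)$ design is a pair $(P,\mathcal{B})$ where $P$ is a set of $v$ points and $\mathcal{B}$ a set of $k$-subsets of $P$ (blocks, also called lines) such that every $2$-subset of $P$ lies in exactly $\lambda$ blocks. A unital of order $n\ge 2$ is a $2$-$(n^3+1,n+1,1)$ design. The incidence graph $G_D$ of a design $D=(P,\mathcal{B})$ is the bipartite graph on vertex set $P\cup\mathcal{B}$ where a point $p$ is adjacent to a block $B$ iff $p\in B$. For a graph $G$ and $S\subseteq V(G)$, $N(S)$ is the set of vertices in $V(G)\setminus S$ adjacent to at least one vertex of $S$; the vertex-isoperimetric number is $i(G)=\min\{|N(S)|/|S| : \emptyset\ne S\subseteq V(G),\ |S|\le |V(G)|/2\}$. A $k$-arc ($k\ge 3$) of a unital is a set of $k$ points no three of which lie on a common line; $m(U)=\max\{k : k\ge 3, U \text{ contains a } k\text{ -arc}\}$. -}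

module Defs where

open import Data.Nat using (ℕ; zero; suc; _+_; _*_; _∸_; _^_; _≤_; _<_; NonZero; z≤n; s≤s)
open import Data.Nat.Base using (>-nonZero)
open import Data.Bool using (Bool; true; false; _∧_; _∨_; not; T)
open import Data.Fin using (Fin; zero; suc; splitAt)
open import Data.Fin.Subset using (Subset; _∈_; _∉_; ∣_∣; Nonempty; inside; outside)
open import Data.Vec using (Vec; []; _∷_; lookup; tabulate; there)
open import Data.Sum using (_⊎_; inj₁; inj₂)
open import Data.Product using (Σ; ∃; ∃-syntax; _×_; _,_)
open import Data.Integer as ℤ using (ℤ; +_)
open import Data.Rational as ℚ using (ℚ)
open import Relation.Binary.PropositionalEquality using (_≡_; _≢_)
open import Function.Definitions using (Injective)

anyᶠ : ∀ {n} → (Fin n → Bool) → Bool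
anyᶠ {zero}  p = false
anyᶠ {suc n} p = p zero ∨ anyᶠ (λ i → p (suc i))

record Design (v k lam : ℕ) : Set where
  field
    b          : ℕ
    block      : Fin b → Subset v
    blocks-set : Injective _≡_ _≡_ block
    block-size : ∀ j → ∣ block j ∣ ≡ k
    pair-count : ∀ (x y : Fin v) → x ≢ y →
                 ∣ tabulate (λ j → lookup (block j) x ∧ lookup (block j) y) ∣ ≡ lam

Unital : ℕ → Set
Unital n = Design (n ^ 3 + 1) (n + 1) 1

record Graph : Set where
  field
    N   : ℕ
    adj : Fin N → Fin N → Bool

nbhd : (G : Graph) → Subset (Graph.N G) → Subset (Graph.N G)
nbhd G S = tabulate (λ x → not (lookup S x) ∧ anyᶠ (λ y → lookup S y ∧ Graph.adj G y x))

nonempty⇒nonZero : ∀ {n} (S : Subset n) → Nonempty S → NonZero ∣ S ∣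
nonempty⇒nonZero (inside ∷ S) _ = _
nonempty⇒nonZero (outside ∷ S) (suc i , there i∈S) =
  nonempty⇒nonZero S (i , i∈S)

isoRatio : (G : Graph) (S : Subset (Graph.N G)) → Nonempty S → ℚ
isoRatio G S ne = ℚ._/_ (+ ∣ nbhd G S ∣) ∣ S ∣ {{nonempty⇒nonZero S ne}}

Admissible : (G : Graph) → Subset (Graph.N G) → Set
Admissible G S = Nonempty S × 2 * ∣ S ∣ ≤ Graph.N G

IsVertexIsoperimetricNumber : Graph → ℚ → Set
IsVertexIsoperimetricNumber G r =
  (∃[ S ] Σ (Admissible G S) (λ a → r ≡ isoRatio G S (Data.Product.proj₁ a)))
  × (∀ S (a : Admissible G S) → r ℚ.≤ isoRatio G S (Data.Product.proj₁ a))

incidenceGraph : ∀ {v k lam} → Design v k lam → Graph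
incidenceGraph {v} D = record { N = v + b ; adj = a }
  where
    open Design D
    a : Fin (v + b) → Fin (v + b) → Bool
    a x y with splitAt v x | splitAt v y
    ... | inj₁ p | inj₂ B = lookup (block B) p
    ... | inj₂ B | inj₁ p = lookup (block B) p
    ... | _      | _      = false

IsArc : ∀ {v k' lam} → Design v k' lam → ℕ → Subset v → Set
IsArc D k A =
  3 ≤ k × ∣ A ∣ ≡ k ×
  (∀ x y z → x ∈ A → y ∈ A → z ∈ A → x ≢ y → y ≢ z → x ≢ z →
     ∀ j → ¬' (x ∈ Design.block D j × y ∈ Design.block D j × z ∈ Design.block D j))
  where
    open import Data.Empty using (⊥)
    ¬' : Set → Set
    ¬' P = P → ⊥

IsMaxArcSize : ∀ {v k' lam} → Design v k' lam → ℕ → Set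
IsMaxArcSize D m = (∃[ A ] IsArc D m A) × (∀ k A → IsArc D k A → k ≤ m)

-- t = ⌊c(n)⌋ where c(n) = n^2 - (√(8n^2+9) - 3)/2 = (2n^2 + 3 - √(8n^2+9))/2.
-- For t : ℕ,  t ≤ c(n)      ⇔ 8n^2+9 ≤ (2n^2+3-2t)^2 with 2t ≤ 2n^2+3,
--             c(n) < t + 1  ⇔ 2t > 2n^2+1  or  (2n^2+1-2t)^2 < 8n^2+9;
-- with truncated subtraction ∸ both side conditions are absorbed.
-- (c(n) > 0 for all n ≥ 1, so its floor is a natural number.)
IsFloorC : ℕ → ℕ → Set
IsFloorC n t =
  8 * n ^ 2 + 9 ≤ (2 * n ^ 2 + 3 ∸ 2 * t) ^ 2 ×
  (2 * n ^ 2 + 1 ∸ 2 * t) ^ 2 < 8 * n ^ 2 + 9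

bound : (n : ℕ) → .{{NonZero n}} → ℕ → ℚ
bound (suc n) x =
  ℚ._/_ (+ 2 ℤ.* (+ (suc n ^ 3 + 1) ℤ.- + x)) (suc n ^ 2 * (suc n ^ 2 + 1))

{-# OPTIONS --safe #-}

-- Let S = A ∪ L (points and lines), Z = N(S), and let V be the set of points in neither S nor Z.
-- No line of L meets V and every line meeting A lies in L ∪ Z, so every line meeting both A and V
-- lies in Z. A line has n + 1 points, so it joins at most (n + 1)²/4 of the |A||V| pairs, whence
-- |A||V| ≤ (n + 1)²/4 · |Z ∩ 𝓑|; moreover second moments of the incidence numbers bound from
-- below the number of lines meeting A, and from above the number of lines missing V. For
-- |V| ≤ t these estimates give |Z| ≥ n³ + 1 − t outright; for |V| > t they bound |Z| / |S|.
-- For the upper bound take an x-arc, x = min(m, t), and fill up with lines to half the graph,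
-- including all lines that meet the arc; then N(S) consists of points off the arc. An arc of x
-- points meets x n² − x(x − 1)/2 lines, and x ≤ c(n) says that these and the arc fit.
module Submission where

open import Defs
open import Data.Bool using (Bool; true; false; _∧_; not)
open import Data.Bool.Properties using (T-≡)
open import Data.Empty using (⊥)
open import Data.Fin using (Fin; zero; suc; _↑ˡ_; _↑ʳ_; splitAt)
import Data.Fin.Properties as Fin
open import Data.Fin.Subset using (Subset; _∈_; ∣_∣; Nonempty)
import Data.Integer as ℤ
import Data.Integer.Properties as ℤ
open import Data.Nat
open import Data.Nat.DivMod using (m/n*n≤m; /-mono-≤; m*n/n≡m)
open import Data.Nat.Properties
open import Algebra.Properties.Semiring.Sum +-*-semiring using (sum; sum-cong-≗; ∑-distrib-+; ∑-comm; *-distribˡ-sum; *-distribʳ-sum; sum-replicate-zero)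
open import Data.Nat.Tactic.RingSolver using (solve-∀)
open import Data.Product using (∃; ∃-syntax; _×_; _,_; proj₁; proj₂)
open import Data.Rational using (ℚ)
import Data.Rational as ℚ
import Data.Rational.Properties as ℚ
open import Data.Rational.Unnormalised using (mkℚᵘ; *≤*)
import Data.Rational.Unnormalised.Properties as ℚᵘ
open import Data.Sum using (inj₁; inj₂; [_,_]′)
open import Data.Vec using (lookup; tabulate; []; _∷_)
open import Data.Vec.Properties using (lookup∘tabulate; lookup⇒[]=)
open import Function using (_∘_; case_of_)
open import Function.Bundles using (Equivalence)
open import Relation.Binary.PropositionalEquality
open import Relation.Nullary using (Dec; yes; no; contradiction)

-- Arithmetic of the floor of c(n)

-- Exhibits y − x as (q − p) + r without truncated subtraction; p ≤ q is usually a sum of hypotheses.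
≤-certificate : ∀ {x y p q} r → p ≤ q → x + q + r ≡ y + p → x ≤ y
≤-certificate {x} {y} {p} {q} r p≤q eq = +-cancelʳ-≤ q x y (begin
  x + q     ≤⟨ m≤m+n (x + q) r ⟩
  x + q + r ≡⟨ eq ⟩
  y + p     ≤⟨ +-monoʳ-≤ y p≤q ⟩
  y + q     ∎)
  where open ≤-Reasoning

-- The refuting counterpart of `≤-certificate`: the equation exhibits by how much `p` exceeds `q`,
-- so an assumed or derived `p ≤ q` is absurd.
<-excess : ∀ {p q} r → p ≤ q → p ≡ suc (q + r) → ⊥
<-excess {q = q} r p≤q refl = <-irrefl refl (≤-trans (s≤s (m≤m+n q r)) p≤q)

-- Evenness is what sharpens d² + d < 2n² + 2 to d² + d ≤ 2n², and it makes (w² + w)/2 a natural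
-- number when the graph is halved.
pronic-even : ∀ d → ∃[ h ] d * d + d ≡ 2 * h
pronic-even zero = 0 , refl
pronic-even (suc d) with pronic-even d
... | h , eq = h + suc d , trans (trans (lhs d) (cong (_+ 2 * suc d) eq)) (rhs h d)
  where
  lhs : ∀ d → suc d * suc d + suc d ≡ d * d + d + 2 * suc d
  lhs = solve-∀
  rhs : ∀ h d → 2 * h + 2 * suc d ≡ 2 * (h + suc d)
  rhs = solve-∀

2m<2n+2⇒m≤n : ∀ {m n} → 2 * m < 2 * n + 2 → m ≤ n
2m<2n+2⇒m≤n {m} {n} p = ≤-pred (*-cancelˡ-< 2 m (suc n) (subst (2 * m <_) (eq n) p))
  where
  eq : ∀ n → 2 * n + 2 ≡ 2 * suc n
  eq = solve-∀

-- Writing t = n² − d turns t ≤ c(n) < t + 1 into (d − 1)(d + 2) < 2n² ≤ d(d + 3).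
floor-gap : ∀ n t → IsFloorC n t →
            ∃[ d ] n * n ≡ t + d × 2 * (n * n) ≤ d * d + 3 * d × d * d + d ≤ 2 * (n * n)
floor-gap n t (lower , upper) with t ≤? n * n
-- For t > n² the truncated base 2n² + 3 ∸ 2t is at most 1, and its square cannot reach 9.
... | no t≰w = contradiction lower (<⇒≱ (≤-<-trans (^-monoˡ-≤ 2 small) (≤-trans (s≤s (s≤s z≤n)) (m≤n+m 9 (8 * n ^ 2)))))
  where
  eq : ∀ n → 2 * (n * (n * 1)) + 3 ≡ 1 + 2 * suc (n * n)
  eq = solve-∀
  small : 2 * n ^ 2 + 3 ∸ 2 * t ≤ 1
  small = begin
    2 * n ^ 2 + 3 ∸ 2 * t                    ≡⟨ cong (_∸ 2 * t) (eq n) ⟩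
    1 + 2 * suc (n * n) ∸ 2 * t              ≤⟨ ∸-monoʳ-≤ (1 + 2 * suc (n * n)) (*-monoʳ-≤ 2 (≰⇒> t≰w)) ⟩
    1 + 2 * suc (n * n) ∸ 2 * suc (n * n)    ≡⟨ m+n∸n≡m 1 (2 * suc (n * n)) ⟩
    1 ∎
    where open ≤-Reasoning
... | yes t≤w = d , w≡ , lower-bound , even-bound
  where
  d = n * n ∸ t
  w≡ : n * n ≡ t + d
  w≡ = sym (m+[n∸m]≡n t≤w)
  n²≡ : n ^ 2 ≡ t + d
  n²≡ = trans (cong (n *_) (*-identityʳ n)) w≡
  shift : ∀ k → 2 * n ^ 2 + k ∸ 2 * t ≡ 2 * d + k
  shift k = begin
    2 * n ^ 2 + k ∸ 2 * t        ≡⟨ cong (λ w → 2 * w + k ∸ 2 * t) n²≡ ⟩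
    2 * (t + d) + k ∸ 2 * t      ≡⟨ cong (_∸ 2 * t) (eq t d k) ⟩
    2 * d + k + 2 * t ∸ 2 * t    ≡⟨ m+n∸n≡m (2 * d + k) (2 * t) ⟩
    2 * d + k ∎
    where
    open ≡-Reasoning
    eq : ∀ t d k → 2 * (t + d) + k ≡ 2 * d + k + 2 * t
    eq = solve-∀
  low : 8 * n ^ 2 + 9 ≤ (2 * d + 3) ^ 2
  low = subst (λ x → 8 * n ^ 2 + 9 ≤ x ^ 2) (shift 3) lower
  up : (2 * d + 1) ^ 2 < 8 * n ^ 2 + 9
  up = subst (λ x → x ^ 2 < 8 * n ^ 2 + 9) (shift 1) upper
  lower-bound : 2 * (n * n) ≤ d * d + 3 * d
  lower-bound = *-cancelˡ-≤ 4 (≤-certificate 0 low (eq n d))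
    where
    eq : ∀ n d → 4 * (2 * (n * n)) + (2 * d + 3) * ((2 * d + 3) * 1) + 0 ≡ 4 * (d * d + 3 * d) + (8 * (n * (n * 1)) + 9)
    eq = solve-∀
  half : ∃[ h ] d * d + d ≡ 2 * h
  half = pronic-even d
  even-bound : d * d + d ≤ 2 * (n * n)
  -- Expanding (2d + 1)² < 8n² + 9 gives d² + d < 2n² + 2; both sides are even, so one may pass to
  -- halves.
  even-bound = subst (_≤ 2 * (n * n)) (sym (proj₂ half)) (*-monoʳ-≤ 2 (2m<2n+2⇒m≤n {proj₁ half} {n * n} (subst (_< 2 * (n * n) + 2) (proj₂ half) weak)))
    where
    weak : d * d + d < 2 * (n * n) + 2
    weak = *-cancelˡ-< 4 _ _ (≤-certificate 0 up (eq n d))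
      where
      eq : ∀ n d → suc (4 * (d * d + d)) + (8 * (n * (n * 1)) + 9) + 0 ≡ 4 * (2 * (n * n) + 2) + suc ((2 * d + 1) * ((2 * d + 1) * 1))
      eq = solve-∀

-- Quarter squares and the numerical inequalities behind both bounds

2xy≤x²+y² : ∀ x y → 2 * (x * y) ≤ x * x + y * y
2xy≤x²+y² x y with ≤-total x y
... | inj₁ x≤y with k , refl ← m≤n⇒∃[o]m+o≡n x≤y = ≤-trans (m≤m+n _ (k * k)) (≤-reflexive (eq x k))
  where
  eq : ∀ x k → 2 * (x * (x + k)) + k * k ≡ x * x + (x + k) * (x + k)
  eq = solve-∀
... | inj₂ y≤x with k , refl ← m≤n⇒∃[o]m+o≡n y≤x = ≤-trans (m≤m+n _ (k * k)) (≤-reflexive (eq y k))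
  where
  eq : ∀ y k → 2 * ((y + k) * y) + k * k ≡ (y + k) * (y + k) + y * y
  eq = solve-∀

-- The largest product of two naturals with sum `s`. Rounding down matters: for n = 2 the floor of
-- c(n) is 2, and 2 · 9/4 would exceed t + 2 = 4.
quarter-square : ℕ → ℕ
quarter-square s = s * s / 4

4ij≤[i+j]² : ∀ i j → i * j * 4 ≤ (i + j) * (i + j)
4ij≤[i+j]² i j = ≤-certificate 0 (2xy≤x²+y² i j) (eq i j)
  where
  eq : ∀ i j → i * j * 4 + (i * i + j * j) + 0 ≡ (i + j) * (i + j) + 2 * (i * j)
  eq = solve-∀

product≤quarter-square : ∀ i j {s} → i + j ≤ s → i * j ≤ quarter-square s
product≤quarter-square i j {s} i+j≤s = begin
  i * j         ≡⟨ m*n/n≡m (i * j) 4 ⟨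
  i * j * 4 / 4 ≤⟨ /-mono-≤ (≤-trans (4ij≤[i+j]² i j) (*-mono-≤ i+j≤s i+j≤s)) (≤-refl {4}) ⟩
  s * s / 4     ∎
  where open ≤-Reasoning

quarter-square-mono : ∀ {s s′} → s ≤ s′ → quarter-square s ≤ quarter-square s′
quarter-square-mono s≤s′ = /-mono-≤ (*-mono-≤ s≤s′ s≤s′) (≤-refl {4})

pronic≤⇒< : ∀ {x} d → d * d + d ≤ x → ∀ c → x < c * c + c → d < c
pronic≤⇒< d d²+d≤x c x<c²+c with d <? c
... | yes d<c = d<c
... | no d≮c = contradiction (≤-<-trans d²+d≤x x<c²+c) (≤⇒≯ (+-mono-≤ (*-mono-≤ c≤d c≤d) c≤d))
  where c≤d = ≮⇒≥ d≮c

-- After replacing the quarter square by (n + 1)²/4, the claim in terms of d is 2d ≤ n² - 2n + 3.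
-- This follows from d² + d ≤ 2n² for n ≥ 4; for n = 2 and n = 3 integrality gives d ≤ 2 and d ≤ 3.
quarter-square≤floor : ∀ n {t d} → 2 ≤ n → n * n ≡ t + d → d * d + d ≤ 2 * (n * n) →
                       2 * quarter-square (n + 1) ≤ t + 2
quarter-square≤floor (suc zero) (s≤s ())
quarter-square≤floor 2 {t} {d} _ w≡ d-upper = +-monoˡ-≤ 2
  (+-cancelʳ-≤ d 2 t (≤-trans (+-monoʳ-≤ 2 (≤-pred (pronic≤⇒< d d-upper 3 (m≤m+n 9 3)))) (≤-reflexive w≡)))
quarter-square≤floor 3 {t} {d} _ w≡ d-upper = +-monoˡ-≤ 2
  (+-cancelʳ-≤ d 6 t (≤-trans (+-monoʳ-≤ 6 (≤-pred (pronic≤⇒< d d-upper 4 (m≤m+n 19 1)))) (≤-reflexive w≡)))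
quarter-square≤floor (suc (suc (suc (suc k)))) {t} {d} _ w≡ d-upper = *-cancelʳ-≤ _ _ 2 (begin
  2 * quarter-square (4 + k + 1) * 2  ≡⟨ eq₁ (quarter-square (4 + k + 1)) ⟩
  quarter-square (4 + k + 1) * 4      ≤⟨ m/n*n≤m ((4 + k + 1) * (4 + k + 1)) 4 ⟩
  (4 + k + 1) * (4 + k + 1)           ≤⟨ ≤-certificate 0 (+-mono-≤ 2d≤ (*-monoˡ-≤ 2 (≤-reflexive w≡))) (eq₂ k t d) ⟩
  (t + 2) * 2 ∎)
  where
  open ≤-Reasoning
  eq₁ : ∀ μ → 2 * μ * 2 ≡ μ * 4
  eq₁ = solve-∀
  eq₂ : ∀ k t d → (4 + k + 1) * (4 + k + 1) + (11 + 6 * k + k * k + (t + d) * 2) + 0 ≡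
                  (t + 2) * 2 + (2 * d + (4 + k) * (4 + k) * 2)
  eq₂ = solve-∀
  eq₃ : ∀ k → (12 + 6 * k + k * k) * (12 + 6 * k + k * k) + 2 * (12 + 6 * k + k * k) ≡
              suc (8 * ((4 + k) * (4 + k)) + (39 + 92 * k + 54 * (k * k) + 12 * (k * k * k) + k * k * k * k))
  eq₃ = solve-∀
  eq₄ : ∀ d → (2 * d) * (2 * d) + 2 * (2 * d) ≡ 4 * (d * d + d)
  eq₄ = solve-∀
  eq₅ : ∀ w → 4 * (2 * w) ≡ 8 * w
  eq₅ = solve-∀
  -- With n = 4 + k the bound is n² - 2n + 3. If 2d reached c = n² - 2n + 4, then c² + 2c ≤ 4 (d² +
  -- d) ≤ 8n², which `eq₃` refutes.
  2d≤ : 2 * d ≤ 11 + 6 * k + k * k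
  2d≤ = ≮⇒≥ λ c≤2d → <-excess _ (begin
    (12 + 6 * k + k * k) * (12 + 6 * k + k * k) + 2 * (12 + 6 * k + k * k)
      ≤⟨ +-mono-≤ (*-mono-≤ c≤2d c≤2d) (*-monoʳ-≤ 2 c≤2d) ⟩
    (2 * d) * (2 * d) + 2 * (2 * d)  ≡⟨ eq₄ d ⟩
    4 * (d * d + d)                  ≤⟨ *-monoʳ-≤ 4 d-upper ⟩
    4 * (2 * ((4 + k) * (4 + k)))    ≡⟨ eq₅ ((4 + k) * (4 + k)) ⟩
    8 * ((4 + k) * (4 + k)) ∎) (eq₃ k)

-- From (t − a)(t − u) ≥ 0.
both-small : ∀ {a u t μ z} → a ≤ t → u ≤ t → μ ≤ t → a * u ≤ μ * z → a + u ≤ z + t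
both-small {a} {u} {t} {μ} {z} a≤t u≤t μ≤t au≤ = ≮⇒≥ λ lt → go lt (m≤n⇒∃[o]m+o≡n a≤t) (m≤n⇒∃[o]m+o≡n u≤t)
  where
  eq₁ : ∀ z a p → suc (z + (a + p)) ≡ a + suc (z + p)
  eq₁ = solve-∀
  eq₂ : ∀ z p q r → suc (z + p) + r + q ≡ suc (z + r + q) + p
  eq₂ = solve-∀
  eq₃ : ∀ z p q r → suc (z + r + q) * (suc (z + p) + r) ≡
        suc ((suc (z + r + q) + p) * z + ((z + r + q) + suc (z + r + q) * r + p * (1 + r + q)))
  eq₃ = solve-∀
  go : z + t < a + u → (∃[ p ] a + p ≡ t) → (∃[ q ] u + q ≡ t) → ⊥
  -- Here a = t - p and u = t - q. If z + t < a + u, then u = z + p + 1 + r and a = z + q + 1 + r,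
  -- so a u exceeds (a + p) z = t z.
  go lt (p , refl) (q , e) with r , refl ← m≤n⇒∃[o]m+o≡n (+-cancelˡ-≤ a (suc (z + p)) u (subst (_≤ a + u) (eq₁ z a p) lt)) =
    <-excess _ (subst (λ x → x * (suc (z + p) + r) ≤ (x + p) * z) a≡ (≤-trans au≤ (*-monoˡ-≤ z μ≤t))) (eq₃ z p q r)
    where
    a≡ : a ≡ suc (z + r + q)
    a≡ = +-cancelʳ-≡ p a _ (trans (sym e) (eq₂ z p q r))

m≤m*m : ∀ m → m ≤ m * m
m≤m*m zero = z≤n
m≤m*m m@(suc _) = m≤m*n m m

-- Let a = t + j. If j ≤ u, the bound on a u suffices; if j > u, count the lines meeting
-- a′ = min (t + 1 + u) w points.
large-small : ∀ {a u t d w μ z l} → t < a → u ≤ t → w ≡ t + d → d * d + d ≤ 2 * w →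
              2 * μ ≤ t + 2 → 2 ≤ μ → a * u ≤ μ * z →
              (∀ {a′} → a′ ≤ a → 2 * (a′ * w) + a′ ≤ 2 * (z + l) + a′ * a′) →
              2 * (a + l) ≤ w * w + w → a + u ≤ z + t
large-small {a} {u} {t} {d} {w} {μ} {z} {l} t<a u≤t w≡ d-upper 2μ≤ 2≤μ au≤ lines size
  with i , refl ← m≤n⇒∃[o]m+o≡n t<a | suc i ≤? u
... | yes i<u with s , refl ← m≤n⇒∃[o]m+o≡n i<u = ≮⇒≥ contra
  where
  contra : z + t < suc t + i + (suc i + s) → ⊥
  contra lt with r , e ← m≤n⇒∃[o]m+o≡n lt =
    -- With u = i + 1 + s and z = i + u - r, one has μ z = 2 μ u - μ (s + 1 + r) ≤ (t + 2) u - 2 (s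
    -- + 1 + r), which is below a u = (t + 1 + i) u.
    <-excess _ (+-mono-≤ (+-mono-≤ (+-mono-≤ au≤ (*-monoˡ-≤ (suc i + s) 2μ≤)) (*-monoˡ-≤ (s + 1 + r) 2≤μ))
                         (*-monoʳ-≤ μ (≤-reflexive z+r≡)))
      (eq₂ t μ z i s r)
    where
    eq₁ : ∀ t i s → suc t + i + (suc i + s) ≡ i + (suc i + s) + suc t
    eq₁ = solve-∀
    eq₁′ : ∀ t z r → suc (z + t) + r ≡ z + r + suc t
    eq₁′ = solve-∀
    z+r≡ : z + r ≡ i + (suc i + s)
    z+r≡ = +-cancelʳ-≡ (suc t) _ _ (trans (sym (eq₁′ t z r)) (trans e (eq₁ t i s)))
    eq₂ : ∀ t μ z i s r →
          (suc t + i) * (suc i + s) + 2 * μ * (suc i + s) + 2 * (s + 1 + r) + μ * (z + r) ≡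
          suc (μ * z + (t + 2) * (suc i + s) + μ * (s + 1 + r) + μ * (i + (suc i + s)) +
               (i * i + i * s + s + 2 * r))
    eq₂ = solve-∀
... | no i≮u with suc u ≤? d
-- Now a′ = t + 1 + u = w - e. The count of lines and `size` give 2 (a - z) ≤ e² + e, while d² - d ≤
-- 2t with d = u + 1 + e gives e² + e ≤ 2 (t - u).
... | yes u<d with e , refl ← m≤n⇒∃[o]m+o≡n u<d | refl ← w≡ =
  *-cancelˡ-≤ 2 (≤-certificate (2 * (u * e))
    (+-mono-≤ (+-mono-≤ (+-mono-≤ (lines (+-monoʳ-≤ (suc t) (≤-pred (≰⇒> i≮u)))) size) d-upper) (m≤m*m u))
    (eq t u e i z l))
  where
  eq : ∀ t u e i z l → 2 * (suc t + i + u) +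
         (2 * (z + l) + (suc t + u) * (suc t + u) +
            ((t + (suc u + e)) * (t + (suc u + e)) + (t + (suc u + e))) + 2 * (t + (suc u + e)) + u * u) +
         2 * (u * e) ≡
       2 * (z + t) + (2 * ((suc t + u) * (t + (suc u + e))) + (suc t + u) + 2 * (suc t + i + l) +
         ((suc u + e) * (suc u + e) + (suc u + e)) + u)
  eq = solve-∀
-- Now a′ = w: its count gives 2 (z + l) ≥ w² + w ≥ 2 (a + l), so a ≤ z, and u ≤ t finishes.
... | no u≮d =
  *-cancelˡ-≤ 2 (≤-certificate 0
    (+-mono-≤ (+-mono-≤ (lines w≤a) size) (*-monoʳ-≤ 2 u≤t)) (eq t u w i z l))
  where
  w≤a : w ≤ suc t + i
  w≤a = ≤-trans (≤-reflexive w≡) (≤-trans (n≤1+n _) (+-monoʳ-≤ (suc t) (≤-trans (≤-pred (≰⇒> u≮d)) (≤-pred (≰⇒> i≮u)))))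
  eq : ∀ t u w i z l → 2 * (suc t + i + u) + (2 * (z + l) + w * w + (w * w + w) + 2 * t) + 0 ≡
       2 * (z + t) + (2 * (w * w) + w + 2 * (suc t + i + l) + 2 * u)
  eq = solve-∀

-- Here n = m + 1 and y counts the points outside V. Since (n² - 1)(n² - n + 1) = m (n³ + 1), the
-- difference Q b - w² u is exactly w m y.
line-bound : ∀ m {w b Q l u y} → w ≡ suc m * suc m → b ≡ w * (m * m + m + 1) → Q ≡ u + (m * m + 2 * m) →
             u + y ≡ suc m * w + 1 → w * w * u + Q * l ≤ Q * b → l * Q ≤ w * m * y
line-bound m {u = u} {y} refl refl refl v≡ h =
  ≤-certificate 0 (+-mono-≤ h (*-monoʳ-≤ (suc m * suc m * m) (≤-reflexive (sym v≡)))) (eq m u y _)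
  where
  eq : ∀ m u y l →
       l * (u + (m * m + 2 * m)) +
         ((u + (m * m + 2 * m)) * (suc m * suc m * (m * m + m + 1)) + suc m * suc m * m * (u + y)) + 0 ≡
       suc m * suc m * m * y +
         (suc m * suc m * (suc m * suc m) * u + (u + (m * m + 2 * m)) * l +
          suc m * suc m * m * (suc m * (suc m * suc m) + 1))
  eq = solve-∀

-- Turns l Q ≤ w (n - 1) y into a bound on 2 g l. The crude d ≤ 2n suffices: to leading order 2 g (n
-- - 1) falls short of 2n⁴ by 4n³, but (w + 1)(w + t) only by d n² ≤ 2n³.
outside-bound : ∀ k {w t d g Q} → w ≡ (3 + k) * (3 + k) → w ≡ t + d → d * d + d ≤ 2 * w →
                g + t ≡ (3 + k) * w + 1 → w + t ≤ Q → 2 * g * (2 + k) ≤ (w + 1) * Q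
outside-bound k {w} {t} {d} {g} {Q} refl w≡ d-upper v≡ w+t≤Q = ≤-trans
  (≤-certificate (d + (14 + 28 * k + 14 * (k * k) + 2 * (k * k * k)))
    (+-mono-≤ (+-mono-≤ (*-monoʳ-≤ (w + 1) (≤-reflexive w≡)) (*-monoʳ-≤ (2 * (2 + k)) (≤-reflexive g+w≡)))
              (*-monoˡ-≤ (w + 2 * (3 + k)) d≤2n))
    (eq k t d g))
  (*-monoʳ-≤ (w + 1) w+t≤Q)
  where
  g+w≡ : g + w ≡ (3 + k) * w + 1 + d
  g+w≡ = trans (cong (g +_) w≡) (trans (sym (+-assoc g t d)) (cong (_+ d) v≡))
  d≤2n : d ≤ 2 * (3 + k)
  d≤2n = ≤-pred (pronic≤⇒< d d-upper (suc (2 * (3 + k))) (≤-trans (m≤m+n _ _) (≤-reflexive (eq₁ k))))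
    where
    eq₁ : ∀ k → suc (2 * ((3 + k) * (3 + k))) + (37 + 18 * k + 2 * (k * k)) ≡
          suc (2 * (3 + k)) * suc (2 * (3 + k)) + suc (2 * (3 + k))
    eq₁ = solve-∀
  eq : ∀ k t d g →
       2 * g * (2 + k) +
         (((3 + k) * (3 + k) + 1) * (t + d) + 2 * (2 + k) * ((3 + k) * ((3 + k) * (3 + k)) + 1 + d) +
          2 * (3 + k) * ((3 + k) * (3 + k) + 2 * (3 + k))) +
         (d + (14 + 28 * k + 14 * (k * k) + 2 * (k * k * k))) ≡
       ((3 + k) * (3 + k) + 1) * ((3 + k) * (3 + k) + t) +
         (((3 + k) * (3 + k) + 1) * ((3 + k) * (3 + k)) + 2 * (2 + k) * (g + (3 + k) * (3 + k)) +
          d * ((3 + k) * (3 + k) + 2 * (3 + k)))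
  eq = solve-∀

-- For n ≥ 3 the two terms 2ga and 2gl are absorbed separately; n = 2 has too little slack for that.
uncovered-large : ∀ n {w t d g z a u μ zl l} → 2 ≤ n → w ≡ n * n → w ≡ t + d → d * d + d ≤ 2 * w →
                  2 * quarter-square (n + 1) ≤ t + 2 → μ ≡ quarter-square (n + 1) →
                  g + t ≡ n * w + 1 → z + a + u ≡ n * w + 1 → t < u → a * u ≤ μ * zl →
                  (∀ {b Q} → b + n * w ≡ w * w + w → suc Q ≡ u + w → w * w * u + Q * l ≤ Q * b) →
                  2 * g * (a + l) ≤ (w * w + w) * (z + zl)
uncovered-large (suc zero) (s≤s ())
uncovered-large 2 {t = t} {g = g} {z} {a} {u} {zl = zl} {l} _ refl _ _ 4≤t+2 refl v≡ z+a+u≡ t<u au≤ lines = begin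
  2 * g * (a + l)                   ≤⟨ *-monoˡ-≤ (a + l) (*-monoʳ-≤ 2 g≤7) ⟩
  -- For n = 2 one has w² + w = 20 and μ = 2. Weights 5 and 10 on 3l ≤ 2 (z + a) and 3a ≤ 2 zl give
  -- 20a + 15l ≤ 10z + 20 zl.
  14 * (a + l)                      ≤⟨ ≤-certificate (10 * z + 6 * a + l) (+-mono-≤ (*-monoʳ-≤ 5 3l≤) (*-monoʳ-≤ 10 3a≤)) (eq₃ a l z zl) ⟩
  20 * (z + zl) ∎
  where
  open ≤-Reasoning
  2≤t : 2 ≤ t
  2≤t = +-cancelʳ-≤ 2 2 t 4≤t+2
  g≤7 : g ≤ 7
  g≤7 = +-cancelʳ-≤ 2 g 7 (≤-trans (+-monoʳ-≤ g 2≤t) (≤-reflexive v≡))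
  3≤u : 3 ≤ u
  3≤u = ≤-trans (s≤s 2≤t) t<u
  eq₁ : ∀ u z a → u + (z + a) ≡ z + a + u
  eq₁ = solve-∀
  eq₀ : ∀ u → suc (u + 3) ≡ u + 4
  eq₀ = solve-∀
  3l≤ : 3 * l ≤ 2 * (z + a)
  3l≤ = *-cancelˡ-≤ 2 (begin
    2 * (3 * l)       ≡⟨ eq₂ l ⟩
    l * 6             ≤⟨ *-monoʳ-≤ l (+-monoˡ-≤ 3 3≤u) ⟩
    l * (u + 3)       ≤⟨ line-bound 1 {l = l} {u} {z + a} refl refl refl (trans (eq₁ u z a) z+a+u≡) (lines {12} {u + 3} refl (eq₀ u)) ⟩
    4 * (z + a)       ≡⟨ *-assoc 2 2 (z + a) ⟩
    2 * (2 * (z + a)) ∎)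
    where
    eq₂ : ∀ l → 2 * (3 * l) ≡ l * 6
    eq₂ = solve-∀
  3a≤ : a * 3 ≤ 2 * zl
  3a≤ = ≤-trans (*-monoʳ-≤ a 3≤u) au≤
  eq₃ : ∀ a l z zl → 14 * (a + l) + (5 * (2 * (z + a)) + 10 * (2 * zl)) + (10 * z + 6 * a + l) ≡
        20 * (z + zl) + (5 * (3 * l) + 10 * (a * 3))
  eq₃ = solve-∀
uncovered-large (suc (suc (suc k))) {w} {t} {d} {g} {z} {a} {u} {μ} {zl} {l} _ refl w≡ d-upper 2μ≤ μ≡ v≡ z+a+u≡ t<u au≤ lines =
  ≤-certificate 0 (+-mono-≤ ga≤ gl≤) (eq₆ g a l w z zl)
  where
  open ≤-Reasoning
  Q : ℕ
  Q = u + ((2 + k) * (2 + k) + 2 * (2 + k))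
  instance
    Q≢0 : NonZero Q
    Q≢0 = >-nonZero (≤-trans (≤-trans (s≤s z≤n) t<u) (m≤m+n u _))
  eq₁ : ∀ u z a → u + (z + a) ≡ z + a + u
  eq₁ = solve-∀
  eq₂ : ∀ u k → suc (u + ((2 + k) * (2 + k) + 2 * (2 + k))) ≡ u + (3 + k) * (3 + k)
  eq₂ = solve-∀
  eq₃ : ∀ k → (3 + k) * (3 + k) * ((2 + k) * (2 + k) + (2 + k) + 1) + (3 + k) * ((3 + k) * (3 + k)) ≡
        (3 + k) * (3 + k) * ((3 + k) * (3 + k)) + (3 + k) * (3 + k)
  eq₃ = solve-∀
  lQ≤ : l * Q ≤ w * (2 + k) * (z + a)
  lQ≤ = line-bound (2 + k) {u = u} refl refl refl (trans (eq₁ u z a) z+a+u≡) (lines (eq₃ k) (eq₂ u k))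
  w+t≤Q : w + t ≤ Q
  w+t≤Q = ≤-pred (begin
    suc (w + t) ≡⟨ +-suc w t ⟨
    w + suc t   ≤⟨ +-monoʳ-≤ w t<u ⟩
    w + u       ≡⟨ +-comm w u ⟩
    u + w       ≡⟨ eq₂ u k ⟨
    suc Q ∎)
  gl≤ : 2 * g * l ≤ (w * w + w) * (z + a)
  gl≤ = *-cancelʳ-≤ _ _ Q (begin
    2 * g * l * Q                        ≡⟨ *-assoc (2 * g) l Q ⟩
    2 * g * (l * Q)                      ≤⟨ *-monoʳ-≤ (2 * g) lQ≤ ⟩
    2 * g * (w * (2 + k) * (z + a))      ≡⟨ eq (2 * g) w (2 + k) (z + a) ⟩
    2 * g * (2 + k) * (w * (z + a))      ≤⟨ *-monoˡ-≤ (w * (z + a)) (outside-bound k {t = t} {d} {g} refl w≡ d-upper v≡ w+t≤Q) ⟩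
    (w + 1) * Q * (w * (z + a))          ≡⟨ eq′ w Q (z + a) ⟩
    (w * w + w) * (z + a) * Q ∎)
    where
    eq : ∀ g w m y → g * (w * m * y) ≡ g * m * (w * y)
    eq = solve-∀
    eq′ : ∀ w q y → (w + 1) * q * (w * y) ≡ (w * w + w) * y * q
    eq′ = solve-∀
  4≤μ : 4 ≤ μ
  4≤μ = subst (4 ≤_) (sym μ≡) (quarter-square-mono {4} (s≤s (s≤s (s≤s (m≤n+m 1 k)))))
  instance
    μ≢0 : NonZero μ
    μ≢0 = >-nonZero (≤-trans (s≤s z≤n) 4≤μ)
  8g≤ : 8 * g ≤ 3 * (w * w + w)
  8g≤ = ≤-certificate (46 + 126 * k + 93 * (k * k) + 28 * (k * k * k) + 3 * (k * k * k * k))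
         (*-monoʳ-≤ 8 (≤-trans (m≤m+n g t) (≤-reflexive v≡))) (eq k g)
    where
    eq : ∀ k g → 8 * g + 8 * ((3 + k) * ((3 + k) * (3 + k)) + 1) +
                   (46 + 126 * k + 93 * (k * k) + 28 * (k * k * k) + 3 * (k * k * k * k)) ≡
         3 * ((3 + k) * (3 + k) * ((3 + k) * (3 + k)) + (3 + k) * (3 + k)) + 8 * g
    eq = solve-∀
  2μ≤u+1 : 2 * μ ≤ u + 1
  2μ≤u+1 = subst (λ x → 2 * x ≤ u + 1) (sym μ≡) (≤-trans 2μ≤ (≤-trans (≤-reflexive (+-suc t 1)) (+-monoˡ-≤ 1 t<u)))
  -- With E = w² + w, `8g≤` gives E + 2g ≤ 7E/4, and μ ≥ 4 gives 7μ/4 ≤ 2μ - 1 ≤ u.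
  factor : (w * w + w + 2 * g) * μ ≤ (w * w + w) * u
  factor = *-cancelˡ-≤ 4 (≤-certificate 0
    (+-mono-≤ (+-mono-≤ (*-monoˡ-≤ μ 8g≤) (*-monoʳ-≤ (4 * (w * w + w)) 2μ≤u+1)) (*-monoʳ-≤ (w * w + w) 4≤μ))
    (eq (w * w + w) g μ u))
    where
    eq : ∀ e g μ u → 4 * ((e + 2 * g) * μ) + (3 * e * μ + 4 * e * (u + 1) + e * μ) + 0 ≡
         4 * (e * u) + (8 * g * μ + 4 * e * (2 * μ) + e * 4)
    eq = solve-∀
  -- The extra (w² + w) a pays for the points of A on the right of `gl≤`, where all z + a points
  -- outside V are charged.
  ga≤ : (w * w + w + 2 * g) * a ≤ (w * w + w) * zl
  ga≤ = *-cancelʳ-≤ _ _ μ (begin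
    (w * w + w + 2 * g) * a * μ   ≡⟨ eq (w * w + w + 2 * g) a μ ⟩
    (w * w + w + 2 * g) * μ * a   ≤⟨ *-monoˡ-≤ a factor ⟩
    (w * w + w) * u * a           ≡⟨ eq′ (w * w + w) u a ⟩
    (w * w + w) * (a * u)         ≤⟨ *-monoʳ-≤ (w * w + w) au≤ ⟩
    (w * w + w) * (μ * zl)        ≡⟨ eq″ (w * w + w) μ zl ⟩
    (w * w + w) * zl * μ          ∎)
    where
    eq : ∀ e a m → e * a * m ≡ e * m * a
    eq = solve-∀
    eq′ : ∀ e u a → e * u * a ≡ e * (a * u)
    eq′ = solve-∀
    eq″ : ∀ e m z → e * (m * z) ≡ e * z * m
    eq″ = solve-∀
  eq₆ : ∀ g a l w z zl → 2 * g * (a + l) + ((w * w + w) * zl + (w * w + w) * (z + a)) + 0 ≡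
        (w * w + w) * (z + zl) + ((w * w + w + 2 * g) * a + 2 * g * l)
  eq₆ = solve-∀

-- In the notation above, a = |A|, l = |L|, u = |V|, z and zl count the points and lines of Z,
-- w = n² and g = n³ + 1 − t.
separator-bound : ∀ n {w t d g z a u zl l} → 2 ≤ n → w ≡ n * n → w ≡ t + d → d * d + d ≤ 2 * w →
                  g + t ≡ n * w + 1 → z + a + u ≡ n * w + 1 → a * u ≤ quarter-square (n + 1) * zl →
                  (∀ {a′} → a′ ≤ a → 2 * (a′ * w) + a′ ≤ 2 * (zl + l) + a′ * a′) →
                  (∀ {b Q} → b + n * w ≡ w * w + w → suc Q ≡ u + w → w * w * u + Q * l ≤ Q * b) →
                  2 * (a + l) ≤ w * w + w →
                  2 * g * (a + l) ≤ (w * w + w) * (z + zl)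
separator-bound n {w} {t} {d} {g} {z} {a} {u} {zl} {l} 2≤n w≡n² w≡ d-upper v≡ z+a+u≡ au≤ few-points few-lines size =
  cases (u ≤? t) (a ≤? t)
  where
  open ≤-Reasoning
  μ : ℕ
  μ = quarter-square (n + 1)
  2μ≤ : 2 * μ ≤ t + 2
  2μ≤ = quarter-square≤floor n 2≤n (trans (sym w≡n²) w≡) (subst (λ x → d * d + d ≤ 2 * x) w≡n² d-upper)
  2≤μ : 2 ≤ μ
  2≤μ = quarter-square-mono {3} (+-monoˡ-≤ 1 2≤n)
  μ≤t : μ ≤ t
  μ≤t = ≤-certificate 0 (+-mono-≤ 2μ≤ 2≤μ) (eq μ t)
    where
    eq : ∀ μ t → μ + (t + 2 + μ) + 0 ≡ t + (2 * μ + 2)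
    eq = solve-∀
  -- Since z + a + u = g + t, the premise says |Z| ≥ g; as 2 |S| ≤ w² + w, the ratio follows.
  conclude : a + u ≤ zl + t → 2 * g * (a + l) ≤ (w * w + w) * (z + zl)
  conclude a+u≤ = begin
    2 * g * (a + l)          ≡⟨ eq g (a + l) ⟩
    2 * (a + l) * g          ≤⟨ *-mono-≤ size g≤ ⟩
    (w * w + w) * (z + zl)   ∎
    where
    eq : ∀ g s → 2 * g * s ≡ 2 * s * g
    eq = solve-∀
    eq′ : ∀ g t z a u zl → g + (z + a + u + (zl + t)) + 0 ≡ z + zl + (g + t + (a + u))
    eq′ = solve-∀
    g≤ : g ≤ z + zl
    g≤ = ≤-certificate 0 (+-mono-≤ (≤-reflexive (trans v≡ (sym z+a+u≡))) a+u≤) (eq′ g t z a u zl)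
  cases : Dec (u ≤ t) → Dec (a ≤ t) → 2 * g * (a + l) ≤ (w * w + w) * (z + zl)
  cases (yes u≤t) (yes a≤t) = conclude (both-small a≤t u≤t μ≤t au≤)
  cases (yes u≤t) (no a≰t) = conclude (large-small (≰⇒> a≰t) u≤t w≡ d-upper 2μ≤ 2≤μ au≤ few-points size)
  cases (no u≰t) _ = uncovered-large n {t = t} {d} {g} 2≤n w≡n² w≡ d-upper 2μ≤ refl v≡ z+a+u≡ (≰⇒> u≰t) au≤ few-lines

-- Put D = w - x = c + d. After inserting the bound on e, the slack is D² + 3D - 2w, which increases
-- with D and is nonnegative already at D = d.
arc-fits : ∀ {w x c d e} → w ≡ x + c + d → 2 * w ≤ d * d + 3 * d →
           2 * e + x * x ≤ 2 * (x * w) + x → 2 * (x + e) ≤ w * w + w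
arc-fits {x = x} {c} {d} {e} refl d-lower lines =
  ≤-certificate (c * c + 2 * (c * d) + 3 * c) (+-mono-≤ lines d-lower) (eq x c d e)
  where
  eq : ∀ x c d e → 2 * (x + e) + (2 * (x * (x + c + d)) + x + (d * d + 3 * d)) + (c * c + 2 * (c * d) + 3 * c) ≡
       (x + c + d) * (x + c + d) + (x + c + d) + (2 * e + x * x + 2 * (x + c + d))
  eq = solve-∀

-- Finite sums and counting

sum-mono-≤ : ∀ {n} {f g : Fin n → ℕ} → (∀ i → f i ≤ g i) → sum f ≤ sum g
sum-mono-≤ {zero}  f≤g = z≤n
sum-mono-≤ {suc n} f≤g = +-mono-≤ (f≤g zero) (sum-mono-≤ (f≤g ∘ suc))

sum-const : ∀ n c → sum {n} (λ _ → c) ≡ n * c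
sum-const zero    c = refl
sum-const (suc n) c = cong (c +_) (sum-const n c)

sum-zero : ∀ {n} {f : Fin n → ℕ} → (∀ i → f i ≡ 0) → sum f ≡ 0
sum-zero {n} f≡0 = trans (sum-cong-≗ f≡0) (sum-replicate-zero n)

term≤sum : ∀ {n} (f : Fin n → ℕ) i → f i ≤ sum f
term≤sum f zero    = m≤m+n (f zero) _
term≤sum f (suc i) = ≤-trans (term≤sum (f ∘ suc) i) (m≤n+m _ (f zero))

sum-↑ : ∀ m {n} (f : Fin (m + n) → ℕ) → sum f ≡ sum (f ∘ (_↑ˡ n)) + sum (f ∘ (m ↑ʳ_))
sum-↑ zero    f = refl
sum-↑ (suc m) f = trans (cong (f zero +_) (sum-↑ m (f ∘ suc))) (sym (+-assoc (f zero) _ _))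

-- Serves sums over y of `codegree x y`, constant except at y = x. The corrections `c` and `d` stand
-- on both sides to avoid subtraction.
sum-agree-except : ∀ {n} {f g : Fin n → ℕ} {c d} i → (∀ j → i ≢ j → f j ≡ g j) → f i + c ≡ g i + d →
                   sum f + c ≡ sum g + d
sum-agree-except {suc n} {f} {g} {c} {d} zero eq eqᵢ = begin
  f zero + sum (f ∘ suc) + c    ≡⟨ swap (f zero) _ c ⟩
  f zero + c + sum (f ∘ suc)    ≡⟨ cong₂ _+_ eqᵢ (sum-cong-≗ (λ j → eq (suc j) λ ())) ⟩
  g zero + d + sum (g ∘ suc)    ≡⟨ swap (g zero) _ d ⟨
  g zero + sum (g ∘ suc) + d    ∎
  where
  open ≡-Reasoning
  swap : ∀ a b c → a + b + c ≡ a + c + b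
  swap = solve-∀
sum-agree-except {suc n} {f} {g} {c} {d} (suc i) eq eqᵢ = begin
  f zero + sum (f ∘ suc) + c     ≡⟨ +-assoc (f zero) _ c ⟩
  f zero + (sum (f ∘ suc) + c)   ≡⟨ cong₂ _+_ (eq zero λ ()) (sum-agree-except i (λ j i≢j → eq (suc j) (i≢j ∘ Fin.suc-injective)) eqᵢ) ⟩
  g zero + (sum (g ∘ suc) + d)   ≡⟨ +-assoc (g zero) _ d ⟨
  g zero + sum (g ∘ suc) + d     ∎
  where open ≡-Reasoning

χ : Bool → ℕ
χ true  = 1
χ false = 0

χ≤1 : ∀ p → χ p ≤ 1
χ≤1 true  = ≤-refl
χ≤1 false = z≤n

χ-idem : ∀ p → χ p * χ p ≡ χ p
χ-idem true  = refl
χ-idem false = refl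

χ-∧ : ∀ p q → χ (p ∧ q) ≡ χ p * χ q
χ-∧ true  q = sym (+-identityʳ (χ q))
χ-∧ false q = refl

count : ∀ {n} → (Fin n → Bool) → ℕ
count p = sum (χ ∘ p)

∣∣≡count : ∀ {n} (S : Subset n) → ∣ S ∣ ≡ count (lookup S)
∣∣≡count []          = refl
∣∣≡count (true ∷ S)  = cong suc (∣∣≡count S)
∣∣≡count (false ∷ S) = ∣∣≡count S

∣tabulate∣≡count : ∀ {n} (p : Fin n → Bool) → ∣ tabulate p ∣ ≡ count p
∣tabulate∣≡count p = trans (∣∣≡count (tabulate p)) (sum-cong-≗ (λ i → cong χ (lookup∘tabulate p i)))

infix 4 _⊑_
_⊑_ : ∀ {n} → (Fin n → Bool) → (Fin n → Bool) → Set
p ⊑ q = ∀ i → p i ≡ true → q i ≡ true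

χ-mono : ∀ {p q} → (p ≡ true → q ≡ true) → χ p ≤ χ q
χ-mono {false} imp = z≤n
χ-mono {true}  imp rewrite imp refl = ≤-refl

count-mono : ∀ {n} {p q : Fin n → Bool} → p ⊑ q → count p ≤ count q
count-mono p⊑q = sum-mono-≤ λ i → χ-mono (p⊑q i)

-- Supplies sets of prescribed size: subsets of A, parts of an arc, and line sets containing all
-- lines that meet it. An optional element is skipped as long as the later ones can still supply
-- `k`.
interpolate : ∀ {n} (p q : Fin n → Bool) → p ⊑ q → ∀ k → count p ≤ k → k ≤ count q →
              ∃[ r ] p ⊑ r × r ⊑ q × count r ≡ k
interpolate {zero} p q p⊑q k _ k≤ = p , (λ ()) , (λ ()) , sym (n≤0⇒n≡0 k≤)
interpolate {suc n} p q p⊑q k ≤k k≤ = step (p zero) (q zero) refl refl ≤k k≤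
  where
  extend : ∀ b {k} → (p zero ≡ true → b ≡ true) → (b ≡ true → q zero ≡ true) →
           (∃[ r ] p ∘ suc ⊑ r × r ⊑ q ∘ suc × count r ≡ k) → ∃[ r ] p ⊑ r × r ⊑ q × count r ≡ χ b + k
  extend b lo hi (r , p⊑r , r⊑q , eq) =
    (λ { zero → b ; (suc i) → r i }) , (λ { zero → lo ; (suc i) → p⊑r i }) ,
    (λ { zero → hi ; (suc i) → r⊑q i }) , cong (χ b +_) eq
  rest : ∀ k → count (p ∘ suc) ≤ k → k ≤ count (q ∘ suc) → ∃[ r ] p ∘ suc ⊑ r × r ⊑ q ∘ suc × count r ≡ k
  rest = interpolate (p ∘ suc) (q ∘ suc) (p⊑q ∘ suc)
  step : ∀ p₀ q₀ → p zero ≡ p₀ → q zero ≡ q₀ → ∀ {k} → χ p₀ + count (p ∘ suc) ≤ k → k ≤ χ q₀ + count (q ∘ suc) →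
         ∃[ r ] p ⊑ r × r ⊑ q × count r ≡ k
  step true  q₀    p≡ q≡ {suc k} (s≤s ≤k) k≤ =
    extend true (λ _ → refl) (λ _ → p⊑q zero p≡) (rest k ≤k (≤-pred (subst (λ b → suc k ≤ χ b + _) (trans (sym q≡) (p⊑q zero p≡)) k≤)))
  step false false p≡ q≡ ≤k k≤ = extend false (λ e → trans (sym p≡) e) (λ ()) (rest _ ≤k k≤)
  step false true  p≡ q≡ {k} ≤k k≤ with k ≤? count (q ∘ suc)
  ... | yes k≤′ = extend false (λ e → trans (sym p≡) e) (λ ()) (rest k ≤k k≤′)
  -- Here `k` is the full count of `q`, so the current element and the whole tail of `q` are forced.
  ... | no k≰ with refl ← ≤-antisym k≤ (≰⇒> k≰) =
    extend true (λ _ → refl) (λ _ → q≡) (rest _ (count-mono (p⊑q ∘ suc)) ≤-refl)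

anyᶠ⁺ : ∀ {n} (p : Fin n → Bool) i → p i ≡ true → anyᶠ p ≡ true
anyᶠ⁺ p zero    e rewrite e = refl
anyᶠ⁺ p (suc i) e with p zero
... | true  = refl
... | false = anyᶠ⁺ (p ∘ suc) i e

anyᶠ⁻ : ∀ {n} (p : Fin n → Bool) → anyᶠ p ≡ true → ∃[ i ] p i ≡ true
anyᶠ⁻ {suc n} p e with p zero in eq
... | true  = zero , eq
... | false with i , pᵢ ← anyᶠ⁻ (p ∘ suc) e = suc i , pᵢ

∧-true : ∀ {p q} → p ∧ q ≡ true → p ≡ true × q ≡ true
∧-true {true} {true} refl = refl , refl

elements : ∀ {n} (p : Fin n → Bool) k → k ≤ count p →
           ∃ λ (f : Fin k → Fin n) → (∀ i j → f i ≡ f j → i ≡ j) × (∀ i → p (f i) ≡ true)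
elements p zero _ = (λ ()) , (λ ()) , λ ()
elements {suc n} p (suc k) k< with p zero in eq
... | false with f , inj , mem ← elements (p ∘ suc) (suc k) k< =
  suc ∘ f , (λ i j → inj i j ∘ Fin.suc-injective) , mem
... | true with f , inj , mem ← elements (p ∘ suc) k (≤-pred k<) =
  (λ { zero → zero ; (suc i) → suc (f i) }) ,
  (λ { zero zero _ → refl ; (suc i) (suc j) e → cong suc (inj i j (Fin.suc-injective e)) }) ,
  (λ { zero → eq ; (suc i) → mem i })

-- Incidence numbers in a unital

module Incidence (n : ℕ) (1≤n : 1 ≤ n) (U : Unital n) where
  open Design U

  v w : ℕ
  v = n ^ 3 + 1
  w = n * n

  v≡ : v ≡ n * w + 1
  v≡ = eq n
    where
    eq : ∀ n → n * (n * (n * 1)) + 1 ≡ n * (n * n) + 1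
    eq = solve-∀

  inc : Fin v → Fin b → ℕ
  inc x B = χ (lookup (block B) x)

  meet : (Fin v → ℕ) → Fin b → ℕ
  meet α B = sum (λ x → α x * inc x B)

  codegree : Fin v → Fin v → ℕ
  codegree x y = sum (λ B → inc x B * inc y B)

  line-size : ∀ B → meet (λ _ → 1) B ≡ n + 1
  line-size B = begin
    sum (λ x → 1 * inc x B) ≡⟨ sum-cong-≗ (λ x → *-identityˡ (inc x B)) ⟩
    sum (λ x → inc x B)     ≡⟨ ∣∣≡count (block B) ⟨
    ∣ block B ∣             ≡⟨ block-size B ⟩
    n + 1                   ∎
    where open ≡-Reasoning

  codegree-distinct : ∀ {x y} → x ≢ y → codegree x y ≡ 1
  codegree-distinct {x} {y} x≢y = begin
    sum (λ B → inc x B * inc y B) ≡⟨ sum-cong-≗ (λ B → sym (χ-∧ (lookup (block B) x) (lookup (block B) y))) ⟩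
    count (λ B → lookup (block B) x ∧ lookup (block B) y) ≡⟨ ∣tabulate∣≡count (λ B → lookup (block B) x ∧ lookup (block B) y) ⟨
    ∣ tabulate (λ B → lookup (block B) x ∧ lookup (block B) y) ∣ ≡⟨ pair-count x y x≢y ⟩
    1 ∎
    where open ≡-Reasoning

  -- Double counting of the pairs (y, B) with both `x` and y on B, weighted by α at y.
  codegree-meet : ∀ α x → sum (λ y → α y * codegree x y) ≡ sum (λ B → inc x B * meet α B)
  codegree-meet α x = begin
    sum (λ y → α y * codegree x y)                        ≡⟨ sum-cong-≗ (λ y → *-distribˡ-sum (α y) (λ B → inc x B * inc y B)) ⟩
    sum (λ y → sum (λ B → α y * (inc x B * inc y B)))     ≡⟨ ∑-comm (λ y B → α y * (inc x B * inc y B)) ⟩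
    sum (λ B → sum (λ y → α y * (inc x B * inc y B)))     ≡⟨ sum-cong-≗ (λ B → sum-cong-≗ (λ y → eq (α y) (inc x B) (inc y B))) ⟩
    sum (λ B → sum (λ y → inc x B * (α y * inc y B)))     ≡⟨ sum-cong-≗ (λ B → *-distribˡ-sum (inc x B) (λ y → α y * inc y B)) ⟨
    sum (λ B → inc x B * meet α B) ∎
    where
    open ≡-Reasoning
    eq : ∀ a i j → a * (i * j) ≡ i * (a * j)
    eq = solve-∀

  codegree-sum : ∀ α x → sum (λ y → α y * codegree x y) + α x ≡ sum α + α x * codegree x x
  codegree-sum α x = sum-agree-except {f = λ y → α y * codegree x y} x
    (λ y x≢y → trans (cong (α y *_) (codegree-distinct x≢y)) (*-identityʳ (α y)))
    (+-comm (α x * codegree x x) (α x))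

  -- Count pairs (y, B) with x and y on B, r being the degree: the lines give r (n + 1); each of the
  -- n³ points y ≠ x gives 1 and x itself gives r. Hence r n = n³.
  degree : ∀ x → codegree x x ≡ w
  degree x = *-cancelˡ-≡ _ _ n {{>-nonZero 1≤n}} (+-cancelʳ-≡ (codegree x x + 1) _ _ (begin
    n * codegree x x + (codegree x x + 1)         ≡⟨ eq₁ n (codegree x x) ⟩
    codegree x x * (n + 1) + 1                    ≡⟨ cong (_+ 1) (*-distribʳ-sum (n + 1) (λ B → inc x B * inc x B)) ⟩
    sum (λ B → inc x B * inc x B * (n + 1)) + 1   ≡⟨ cong (_+ 1) (sum-cong-≗ (λ B → cong₂ _*_ (χ-idem (lookup (block B) x)) (sym (line-size B)))) ⟩
    sum (λ B → inc x B * meet (λ _ → 1) B) + 1    ≡⟨ cong (_+ 1) (codegree-meet (λ _ → 1) x) ⟨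
    sum (λ y → 1 * codegree x y) + 1              ≡⟨ codegree-sum (λ _ → 1) x ⟩
    sum {v} (λ _ → 1) + 1 * codegree x x          ≡⟨ cong₂ _+_ (trans (sum-const v 1) (trans (*-identityʳ v) v≡)) (*-identityˡ _) ⟩
    n * w + 1 + codegree x x                      ≡⟨ eq₂ n w (codegree x x) ⟩
    n * w + (codegree x x + 1) ∎))
    where
    open ≡-Reasoning
    eq₁ : ∀ n r → n * r + (r + 1) ≡ r * (n + 1) + 1
    eq₁ = solve-∀
    eq₂ : ∀ n w r → n * w + 1 + r ≡ n * w + (r + 1)
    eq₂ = solve-∀

  meet-sum : ∀ α → sum (meet α) ≡ sum α * w
  meet-sum α = begin
    sum (meet α)                                ≡⟨ ∑-comm (λ B x → α x * inc x B) ⟩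
    sum (λ x → sum (λ B → α x * inc x B))       ≡⟨ sum-cong-≗ (λ x → sym (*-distribˡ-sum (α x) (inc x))) ⟩
    sum (λ x → α x * sum (inc x))               ≡⟨ sum-cong-≗ (λ x → cong (α x *_) (trans (sum-cong-≗ (λ B → sym (χ-idem (lookup (block B) x)))) (degree x))) ⟩
    sum (λ x → α x * w)                         ≡⟨ *-distribʳ-sum w α ⟨
    sum α * w ∎
    where open ≡-Reasoning

  -- The bilinear form of the matrix identity N Nᵀ = J + (n² - 1) I for the incidence matrix N, with
  -- the negative diagonal term moved to the left. It yields all second moments used below.
  meet-product : ∀ α β → sum (λ B → meet α B * meet β B) + sum (λ x → α x * β x) ≡
                 sum α * sum β + sum (λ x → α x * β x) * w
  meet-product α β = begin
    sum (λ B → meet α B * meet β B) + sum αβ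
      ≡⟨ cong (_+ sum αβ) (sum-cong-≗ (λ B → *-distribʳ-sum (meet β B) (λ x → α x * inc x B))) ⟩
    sum (λ B → sum (λ x → α x * inc x B * meet β B)) + sum αβ
      ≡⟨ cong (_+ sum αβ) (∑-comm (λ B x → α x * inc x B * meet β B)) ⟩
    sum (λ x → sum (λ B → α x * inc x B * meet β B)) + sum αβ
      ≡⟨ ∑-distrib-+ (λ x → sum (λ B → α x * inc x B * meet β B)) αβ ⟨
    sum (λ x → sum (λ B → α x * inc x B * meet β B) + αβ x)
      ≡⟨ sum-cong-≗ at-point ⟩
    sum (λ x → α x * sum β + αβ x * w)
      ≡⟨ ∑-distrib-+ (λ x → α x * sum β) (λ x → αβ x * w) ⟩
    sum (λ x → α x * sum β) + sum (λ x → αβ x * w)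
      ≡⟨ cong₂ _+_ (*-distribʳ-sum (sum β) α) (*-distribʳ-sum w αβ) ⟨
    sum α * sum β + sum αβ * w ∎
    where
    open ≡-Reasoning
    αβ : Fin v → ℕ
    αβ x = α x * β x
    eq : ∀ a s b w → a * (s + b * w) ≡ a * s + a * b * w
    eq = solve-∀
    at-point : ∀ x → sum (λ B → α x * inc x B * meet β B) + αβ x ≡ α x * sum β + αβ x * w
    at-point x = begin
      sum (λ B → α x * inc x B * meet β B) + αβ x      ≡⟨ cong (_+ αβ x) (sum-cong-≗ (λ B → *-assoc (α x) (inc x B) (meet β B))) ⟩
      sum (λ B → α x * (inc x B * meet β B)) + αβ x    ≡⟨ cong (_+ αβ x) (*-distribˡ-sum (α x) (λ B → inc x B * meet β B)) ⟨
      α x * sum (λ B → inc x B * meet β B) + α x * β x ≡⟨ *-distribˡ-+ (α x) _ (β x) ⟨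
      α x * (sum (λ B → inc x B * meet β B) + β x)     ≡⟨ cong (λ s → α x * (s + β x)) (codegree-meet β x) ⟨
      α x * (sum (λ y → β y * codegree x y) + β x)     ≡⟨ cong (α x *_) (codegree-sum β x) ⟩
      α x * (sum β + β x * codegree x x)               ≡⟨ cong (λ r → α x * (sum β + β x * r)) (degree x) ⟩
      α x * (sum β + β x * w)                          ≡⟨ eq (α x) (sum β) (β x) w ⟩
      α x * sum β + α x * β x * w ∎

  -- Flags counted in two ways give b (n + 1) = (n³ + 1) n². The form b + n w = w² + w states b = n⁴
  -- - n³ + n² without subtraction.
  line-count : b + n * w ≡ w * w + w
  line-count = *-cancelʳ-≡ _ _ (n + 1) {{>-nonZero (m≤n+m 1 n)}} (begin
    (b + n * w) * (n + 1)               ≡⟨ *-distribʳ-+ (n + 1) b (n * w) ⟩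
    b * (n + 1) + n * w * (n + 1)       ≡⟨ cong (_+ n * w * (n + 1)) flags ⟩
    (n * w + 1) * w + n * w * (n + 1)   ≡⟨ eq n ⟩
    (w * w + w) * (n + 1) ∎)
    where
    open ≡-Reasoning
    eq : ∀ n → (n * (n * n) + 1) * (n * n) + n * (n * n) * (n + 1) ≡ (n * n * (n * n) + n * n) * (n + 1)
    eq = solve-∀
    flags : b * (n + 1) ≡ (n * w + 1) * w
    flags = begin
      b * (n + 1)                 ≡⟨ sum-const b (n + 1) ⟨
      sum {b} (λ _ → n + 1)       ≡⟨ sum-cong-≗ line-size ⟨
      sum (meet (λ _ → 1))        ≡⟨ meet-sum (λ _ → 1) ⟩
      sum {v} (λ _ → 1) * w       ≡⟨ cong (_* w) (trans (sum-const v 1) (trans (*-identityʳ v) v≡)) ⟩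
      (n * w + 1) * w ∎

  meet-mono : ∀ {α β} → (∀ x → α x ≤ β x) → ∀ B → meet α B ≤ meet β B
  meet-mono α≤β B = sum-mono-≤ λ x → *-monoˡ-≤ (inc x B) (α≤β x)

  meet-square : ∀ p → sum (λ B → meet (χ ∘ p) B * meet (χ ∘ p) B) + count p ≡ count p * count p + count p * w
  meet-square p = subst (λ s → sum (λ B → meet (χ ∘ p) B * meet (χ ∘ p) B) + s ≡ count p * count p + s * w) (sum-cong-≗ (χ-idem ∘ p)) (meet-product (χ ∘ p) (χ ∘ p))

  meet-cross : ∀ {α β} → (∀ x → α x * β x ≡ 0) → sum (λ B → meet α B * meet β B) ≡ sum α * sum β
  meet-cross {α} {β} αβ≡0 = begin
    sum (λ B → meet α B * meet β B)                             ≡⟨ +-identityʳ _ ⟨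
    sum (λ B → meet α B * meet β B) + 0                         ≡⟨ subst (λ s → sum (λ B → meet α B * meet β B) + s ≡ sum α * sum β + s * w) (sum-zero αβ≡0) (meet-product α β) ⟩
    sum α * sum β + 0                                           ≡⟨ +-identityʳ _ ⟩
    sum α * sum β ∎
    where open ≡-Reasoning

  -- 1 ≥ (3m − m²)/2 for m ≥ 1, with equality when m ≤ 2.
  lines-meeting : ∀ p c → (∀ B → 0 < meet (χ ∘ p) B → 1 ≤ c B) →
                  2 * (count p * w) + count p ≤ 2 * sum c + count p * count p
  lines-meeting p c covers = ≤-certificate 0
    (+-mono-≤ summed (≤-reflexive (meet-square p)))
    (eq (count p) w (sum c) (sum (λ B → meet (χ ∘ p) B * meet (χ ∘ p) B)))
    where
    m : Fin b → ℕ
    m = meet (χ ∘ p)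
    eq : ∀ a w c s → 2 * (a * w) + a + (2 * c + s + (a * a + a * w)) + 0 ≡
         2 * c + a * a + (3 * (a * w) + (s + a))
    eq = solve-∀
    quadratic : ∀ m c → (0 < m → 1 ≤ c) → 3 * m ≤ 2 * c + m * m
    quadratic zero    c _ = z≤n
    quadratic (suc m) c 1≤c with 1≤c (s≤s z≤n)
    ... | s≤s {n = c′} _ = ≤-certificate (2 * c′) (m≤m*m m) (eq′ m c′)
      where
      eq′ : ∀ m c → 3 * suc m + m * m + 2 * c ≡ 2 * suc c + suc m * suc m + m
      eq′ = solve-∀
    summed : 3 * (count p * w) ≤ 2 * sum c + sum (λ B → m B * m B)
    summed = begin
      3 * (count p * w)                            ≡⟨ cong (3 *_) (meet-sum (χ ∘ p)) ⟨
      3 * sum m                                    ≡⟨ *-distribˡ-sum 3 m ⟩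
      sum (λ B → 3 * m B)                          ≤⟨ sum-mono-≤ (λ B → quadratic (m B) (c B) (covers B)) ⟩
      sum (λ B → 2 * c B + m B * m B)              ≡⟨ ∑-distrib-+ (λ B → 2 * c B) (λ B → m B * m B) ⟩
      sum (λ B → 2 * c B) + sum (λ B → m B * m B)  ≡⟨ cong (_+ sum (λ B → m B * m B)) (*-distribˡ-sum 2 c) ⟨
      2 * sum c + sum (λ B → m B * m B)            ∎
      where open ≤-Reasoning

  -- The reverse of `lines-meeting`: (3m - m²)/2 is 0 at m = 0 and exactly 1 at m = 1 and m = 2, so
  -- for arcs the second moments bound the number of meeting lines from above.
  lines-meeting-arc : ∀ p c → (∀ B → meet (χ ∘ p) B ≤ 2) → (∀ B → c B ≤ 1) → (∀ B → meet (χ ∘ p) B ≡ 0 → c B ≡ 0) →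
                      2 * sum c + count p * count p ≤ 2 * (count p * w) + count p
  lines-meeting-arc p c m≤2 c≤1 covers = ≤-certificate 0
    (+-mono-≤ summed (≤-reflexive (sym (meet-square p))))
    (eq (count p) w (sum c) (sum (λ B → meet (χ ∘ p) B * meet (χ ∘ p) B)))
    where
    m : Fin b → ℕ
    m = meet (χ ∘ p)
    eq : ∀ a w c s → 2 * c + a * a + (3 * (a * w) + (s + a)) + 0 ≡
         2 * (a * w) + a + (2 * c + s + (a * a + a * w))
    eq = solve-∀
    quadratic : ∀ {m c} → m ≤ 2 → c ≤ 1 → (m ≡ 0 → c ≡ 0) → 2 * c + m * m ≤ 3 * m
    quadratic {0} _ _ c≡0 rewrite c≡0 refl = z≤n
    quadratic {1} _ c≤1 _ = +-monoˡ-≤ 1 (*-monoʳ-≤ 2 c≤1)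
    quadratic {2} _ c≤1 _ = +-monoˡ-≤ 4 (*-monoʳ-≤ 2 c≤1)
    quadratic {suc (suc (suc _))} (s≤s (s≤s ()))
    summed : 2 * sum c + sum (λ B → m B * m B) ≤ 3 * (count p * w)
    summed = begin
      2 * sum c + sum (λ B → m B * m B)            ≡⟨ cong (_+ sum (λ B → m B * m B)) (*-distribˡ-sum 2 c) ⟩
      sum (λ B → 2 * c B) + sum (λ B → m B * m B)  ≡⟨ ∑-distrib-+ (λ B → 2 * c B) (λ B → m B * m B) ⟨
      sum (λ B → 2 * c B + m B * m B)              ≤⟨ sum-mono-≤ (λ B → quadratic (m≤2 B) (c≤1 B) (covers B)) ⟩
      sum (λ B → 3 * m B)                          ≡⟨ *-distribˡ-sum 3 m ⟨
      3 * sum m                                    ≡⟨ cong (3 *_) (meet-sum (χ ∘ p)) ⟩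
      3 * (count p * w)                            ∎
      where open ≤-Reasoning

  -- Cauchy–Schwarz for the incidence numbers m, as the sum of the AM-GM bounds
  -- 2 (Q w) m ≤ (w m)² + Q² over the lines outside ℓ.
  lines-avoiding : ∀ p ℓ {Q} → 1 ≤ Q → (∀ B → ℓ B ≡ true → meet (χ ∘ p) B ≡ 0) → suc Q ≡ count p + w →
                   w * w * count p + Q * count ℓ ≤ Q * b
  lines-avoiding p ℓ {Q} 1≤Q avoid Q≡ = *-cancelˡ-≤ Q {{>-nonZero 1≤Q}} (≤-certificate 0
    (+-mono-≤ summed (*-monoʳ-≤ (w * w) (≤-reflexive square))) (eq (count p) w (count ℓ) Q b _))
    where
    m : Fin b → ℕ
    m = meet (χ ∘ p)
    S : ℕ
    S = sum (λ B → m B * m B)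
    square : S ≡ count p * Q
    square = +-cancelʳ-≡ (count p) _ _ (begin
      S + count p                            ≡⟨ meet-square p ⟩
      count p * count p + count p * w        ≡⟨ *-distribˡ-+ (count p) (count p) w ⟨
      count p * (count p + w)                ≡⟨ cong (count p *_) Q≡ ⟨
      count p * suc Q                        ≡⟨ *-suc (count p) Q ⟩
      count p + count p * Q                  ≡⟨ +-comm (count p) _ ⟩
      count p * Q + count p ∎)
      where open ≡-Reasoning
    eq : ∀ a w l q b s → q * (w * w * a + q * l) + (w * w * s + b * (q * q) + w * w * (a * q)) + 0 ≡
         q * (q * b) + (2 * (q * w) * (a * w) + q * q * l + w * w * s)
    eq = solve-∀
    -- On a line of ℓ, where m = 0, the term with `χ ℓᴮ` uses up the Q² on the right, so the sum may
    -- run over all lines.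
    AM-GM : ∀ m ℓᴮ → (ℓᴮ ≡ true → m ≡ 0) → 2 * (Q * w) * m + Q * Q * χ ℓᴮ ≤ w * w * (m * m) + Q * Q
    AM-GM m false _ = ≤-trans (≤-reflexive (eq₁ Q w m)) (≤-trans (2xy≤x²+y² (w * m) Q) (≤-reflexive (eq₂ Q w m)))
      where
      eq₁ : ∀ q w m → 2 * (q * w) * m + q * q * 0 ≡ 2 * (w * m * q)
      eq₁ = solve-∀
      eq₂ : ∀ q w m → w * m * (w * m) + q * q ≡ w * w * (m * m) + q * q
      eq₂ = solve-∀
    AM-GM m true m≡0 rewrite m≡0 refl = ≤-reflexive (eq₁ Q w)
      where
      eq₁ : ∀ q w → 2 * (q * w) * 0 + q * q * 1 ≡ w * w * 0 + q * q
      eq₁ = solve-∀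
    summed : 2 * (Q * w) * (count p * w) + Q * Q * count ℓ ≤ w * w * S + b * (Q * Q)
    summed = begin
      2 * (Q * w) * (count p * w) + Q * Q * count ℓ
        ≡⟨ cong (λ s → 2 * (Q * w) * s + Q * Q * count ℓ) (meet-sum (χ ∘ p)) ⟨
      2 * (Q * w) * sum m + Q * Q * count ℓ
        ≡⟨ cong₂ _+_ (*-distribˡ-sum (2 * (Q * w)) m) (*-distribˡ-sum (Q * Q) (χ ∘ ℓ)) ⟩
      sum (λ B → 2 * (Q * w) * m B) + sum (λ B → Q * Q * χ (ℓ B))
        ≡⟨ ∑-distrib-+ (λ B → 2 * (Q * w) * m B) (λ B → Q * Q * χ (ℓ B)) ⟨
      sum (λ B → 2 * (Q * w) * m B + Q * Q * χ (ℓ B))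
        ≤⟨ sum-mono-≤ (λ B → AM-GM (m B) (ℓ B) (avoid B)) ⟩
      sum (λ B → w * w * (m B * m B) + Q * Q)
        ≡⟨ ∑-distrib-+ (λ B → w * w * (m B * m B)) (λ _ → Q * Q) ⟩
      sum (λ B → w * w * (m B * m B)) + sum {b} (λ _ → Q * Q)
        ≡⟨ cong₂ _+_ (sym (*-distribˡ-sum (w * w) (λ B → m B * m B))) (sum-const b (Q * Q)) ⟩
      w * w * S + b * (Q * Q) ∎
      where open ≤-Reasoning

-- Neighbourhoods in the incidence graph

-- `ℚ._/_` reduces fractions, so the comparison is made in the unnormalised rationals, where cross
-- multiplication sees the given numerators and denominators.
/-mono-× : ∀ p d p′ d′ .{{_ : NonZero d}} .{{_ : NonZero d′}} → p * d′ ≤ p′ * d →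
           (ℤ.+ p) ℚ./ d ℚ.≤ (ℤ.+ p′) ℚ./ d′
/-mono-× p (suc d) p′ (suc d′) le = ℚ.toℚᵘ-cancel-≤
  (ℚᵘ.≤-respˡ-≃ (ℚᵘ.≃-sym (ℚ.toℚᵘ-fromℚᵘ (mkℚᵘ (ℤ.+ p) d)))
  (ℚᵘ.≤-respʳ-≃ (ℚᵘ.≃-sym (ℚ.toℚᵘ-fromℚᵘ (mkℚᵘ (ℤ.+ p′) d′)))
  (*≤* (subst₂ ℤ._≤_ (ℤ.pos-* p (suc d′)) (ℤ.pos-* p′ (suc d)) (ℤ.+≤+ le)))))

bound-numerator : ∀ {v x} → x ≤ v → ℤ.+ 2 ℤ.* (ℤ.+ v ℤ.- ℤ.+ x) ≡ ℤ.+ (2 * (v ∸ x))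
bound-numerator {v} {x} x≤v =
  trans (cong (ℤ.+ 2 ℤ.*_) (trans (ℤ.m-n≡m⊖n v x) (ℤ.⊖-≥ x≤v))) (sym (ℤ.pos-* 2 (v ∸ x)))

bound≤ : ∀ n .{{_ : NonZero n}} {x} p d .{{_ : NonZero d}} → x ≤ n ^ 3 + 1 →
         2 * (n ^ 3 + 1 ∸ x) * d ≤ p * (n ^ 2 * (n ^ 2 + 1)) → bound n x ℚ.≤ (ℤ.+ p) ℚ./ d
bound≤ (suc k) {x} p d x≤v le rewrite bound-numerator x≤v =
  /-mono-× (2 * (suc k ^ 3 + 1 ∸ x)) (suc k ^ 2 * (suc k ^ 2 + 1)) p d le

≤bound : ∀ n .{{_ : NonZero n}} {x} p d .{{_ : NonZero d}} → x ≤ n ^ 3 + 1 →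
         p * (n ^ 2 * (n ^ 2 + 1)) ≤ 2 * (n ^ 3 + 1 ∸ x) * d → (ℤ.+ p) ℚ./ d ℚ.≤ bound n x
≤bound (suc k) {x} p d x≤v le rewrite bound-numerator x≤v =
  /-mono-× p d (2 * (suc k ^ 3 + 1 ∸ x)) (suc k ^ 2 * (suc k ^ 2 + 1)) le

module _ (G : Graph) (S : Subset (Graph.N G)) where
  lookup-nbhd : ∀ i → lookup (nbhd G S) i ≡ not (lookup S i) ∧ anyᶠ (λ y → lookup S y ∧ Graph.adj G y i)
  lookup-nbhd = lookup∘tabulate _

  nbhd⁺ : ∀ {y i} → lookup S y ≡ true → Graph.adj G y i ≡ true → lookup S i ≡ false → lookup (nbhd G S) i ≡ true
  nbhd⁺ {y} {i} Sy yi Si = begin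
    lookup (nbhd G S) i                                                   ≡⟨ lookup-nbhd i ⟩
    not (lookup S i) ∧ anyᶠ (λ y → lookup S y ∧ Graph.adj G y i)          ≡⟨ cong (λ b → not b ∧ anyᶠ (λ y → lookup S y ∧ Graph.adj G y i)) Si ⟩
    anyᶠ (λ y → lookup S y ∧ Graph.adj G y i)                             ≡⟨ anyᶠ⁺ _ y (cong₂ _∧_ Sy yi) ⟩
    true ∎
    where open ≡-Reasoning

  nbhd⁻ : ∀ {i} → lookup (nbhd G S) i ≡ true →
          lookup S i ≡ false × ∃[ y ] lookup S y ≡ true × Graph.adj G y i ≡ true
  nbhd⁻ {i} Ni with ∧-true (trans (sym (lookup-nbhd i)) Ni)
  ... | notSi , any with y , both ← anyᶠ⁻ _ any = not-true notSi , y , ∧-true both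
    where
    not-true : ∀ {b} → not b ≡ true → b ≡ false
    not-true {false} _ = refl

module IncidenceGraph {v k lam} (D : Design v k lam) where
  open Design D
  open Graph (incidenceGraph D) using (adj)

  adj-point-line : ∀ x B → adj (x ↑ˡ b) (v ↑ʳ B) ≡ lookup (block B) x
  adj-point-line x B rewrite Fin.splitAt-↑ˡ v x b | Fin.splitAt-↑ʳ v b B = refl

  adj-line-point : ∀ B x → adj (v ↑ʳ B) (x ↑ˡ b) ≡ lookup (block B) x
  adj-line-point B x rewrite Fin.splitAt-↑ˡ v x b | Fin.splitAt-↑ʳ v b B = refl

  adj-line⁻ : ∀ {y B} → adj y (v ↑ʳ B) ≡ true → ∃[ x ] x ↑ˡ b ≡ y × lookup (block B) x ≡ true
  adj-line⁻ {y} {B} yB with splitAt v y in eq | splitAt v (v ↑ʳ B) | Fin.splitAt-↑ʳ v b B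
  ... | inj₁ x | inj₂ B | refl = x , Fin.splitAt⁻¹-↑ˡ eq , yB

-- Separation of the points by a vertex set, and the lower bound

module _ {n : ℕ} (2≤n : 2 ≤ n) (U : Unital n) where
  open Incidence n (≤-trans (s≤s z≤n) 2≤n) U
  open IncidenceGraph U
  open Design U using (b; block)

  private
    G : Graph
    G = incidenceGraph U

  4≤w : 4 ≤ w
  4≤w = *-mono-≤ 2≤n 2≤n

  -- The order is odd, because w² + w is even; an admissible set therefore has at most (w² + w)/2
  -- vertices, which is where the denominator of the bounds comes from.
  order : v + b ≡ suc (w * w + w)
  order = begin
    v + b           ≡⟨ cong (_+ b) v≡ ⟩
    n * w + 1 + b   ≡⟨ eq (n * w) b ⟩
    suc (b + n * w) ≡⟨ cong suc line-count ⟩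
    suc (w * w + w) ∎
    where
    open ≡-Reasoning
    eq : ∀ x b → x + 1 + b ≡ suc (b + x)
    eq = solve-∀

  denominator : n ^ 2 * (n ^ 2 + 1) ≡ w * w + w
  denominator = eq n
    where
    eq : ∀ n → n * (n * 1) * (n * (n * 1) + 1) ≡ n * n * (n * n) + n * n
    eq = solve-∀

  w≤v : w ≤ v
  w≤v = ≤-trans (m≤n*m w n {{>-nonZero (≤-trans (s≤s z≤n) 2≤n)}}) (≤-trans (m≤m+n (n * w) 1) (≤-reflexive (sym v≡)))

  ∣∣-split : ∀ (S : Subset (v + b)) → ∣ S ∣ ≡ count (λ x → lookup S (x ↑ˡ b)) + count (λ B → lookup S (v ↑ʳ B))
  ∣∣-split S = trans (∣∣≡count S) (sum-↑ v (χ ∘ lookup S))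

  module Separation (S : Subset (v + b)) where
    A Z V : Fin v → Bool
    A x = lookup S (x ↑ˡ b)
    Z x = lookup (nbhd G S) (x ↑ˡ b)
    V x = not (A x) ∧ not (Z x)

    L Zᴸ : Fin b → Bool
    L B = lookup S (v ↑ʳ B)
    Zᴸ B = lookup (nbhd G S) (v ↑ʳ B)

    partition : ∀ x → χ (Z x) + χ (A x) + χ (V x) ≡ 1
    partition x with A x in Ax | Z x in Zx
    ... | false | false = refl
    ... | false | true  = refl
    ... | true  | false = refl
    ... | true  | true  = case trans (sym Ax) (proj₁ (nbhd⁻ G S Zx)) of λ ()

    partition-count : count Z + count A + count V ≡ n * w + 1
    partition-count = begin
      count Z + count A + count V                ≡⟨ cong (_+ count V) (∑-distrib-+ (χ ∘ Z) (χ ∘ A)) ⟨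
      sum (λ x → χ (Z x) + χ (A x)) + count V    ≡⟨ ∑-distrib-+ (λ x → χ (Z x) + χ (A x)) (χ ∘ V) ⟨
      sum (λ x → χ (Z x) + χ (A x) + χ (V x))    ≡⟨ sum-cong-≗ partition ⟩
      sum {v} (λ _ → 1)                          ≡⟨ sum-const v 1 ⟩
      v * 1                                      ≡⟨ *-identityʳ v ⟩
      v                                          ≡⟨ v≡ ⟩
      n * w + 1 ∎
      where open ≡-Reasoning

    line-in-S : ∀ B → L B ≡ true → meet (χ ∘ V) B ≡ 0
    line-in-S B LB = sum-zero (λ x → at x)
      where
      at : ∀ x → χ (V x) * inc x B ≡ 0
      at x with lookup (block B) x in xB
      ... | false = *-zeroʳ (χ (V x))
      ... | true with A x in Ax
      ...   | true = refl
      ...   | false rewrite nbhd⁺ G S LB (trans (adj-line-point B x) xB) Ax = refl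

    line-outside : ∀ B → L B ≡ false → Zᴸ B ≡ false → meet (χ ∘ A) B ≡ 0
    line-outside B LB ZB = sum-zero (λ x → at x)
      where
      at : ∀ x → χ (A x) * inc x B ≡ 0
      at x with A x in Ax
      ... | false = refl
      ... | true with lookup (block B) x in xB
      ...   | false = refl
      ...   | true = case trans (sym ZB) (nbhd⁺ G S Ax (trans (adj-point-line x B) xB) LB) of λ ()

    cross : count A * count V ≤ quarter-square (n + 1) * count Zᴸ
    cross = begin
      count A * count V                                  ≡⟨ meet-cross disjoint ⟨
      sum (λ B → meet (χ ∘ A) B * meet (χ ∘ V) B)        ≤⟨ sum-mono-≤ at ⟩
      sum (λ B → quarter-square (n + 1) * χ (Zᴸ B))      ≡⟨ *-distribˡ-sum (quarter-square (n + 1)) (χ ∘ Zᴸ) ⟨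
      quarter-square (n + 1) * count Zᴸ                  ∎
      where
      open ≤-Reasoning
      disjoint : ∀ x → χ (A x) * χ (V x) ≡ 0
      disjoint x with A x
      ... | true  = refl
      ... | false = refl
      meets : ∀ B → meet (χ ∘ A) B + meet (χ ∘ V) B ≤ n + 1
      meets B = begin
        meet (χ ∘ A) B + meet (χ ∘ V) B                    ≡⟨ ∑-distrib-+ (λ x → χ (A x) * inc x B) (λ x → χ (V x) * inc x B) ⟨
        sum (λ x → χ (A x) * inc x B + χ (V x) * inc x B)  ≡⟨ sum-cong-≗ (λ x → sym (*-distribʳ-+ (inc x B) (χ (A x)) (χ (V x)))) ⟩
        meet (λ x → χ (A x) + χ (V x)) B                   ≤⟨ meet-mono (λ x → ≤-trans (m≤n+m _ (χ (Z x))) (≤-reflexive (trans (sym (+-assoc (χ (Z x)) _ _)) (partition x)))) B ⟩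
        meet (λ _ → 1) B                                   ≡⟨ line-size B ⟩
        n + 1                                              ∎
      at : ∀ B → meet (χ ∘ A) B * meet (χ ∘ V) B ≤ quarter-square (n + 1) * χ (Zᴸ B)
      at B with Zᴸ B in ZB | L B in LB
      ... | true | _ = ≤-trans (product≤quarter-square (meet (χ ∘ A) B) (meet (χ ∘ V) B) (meets B))
                               (≤-reflexive (sym (*-identityʳ (quarter-square (n + 1)))))
      ... | false | true rewrite line-in-S B LB | *-zeroʳ (meet (χ ∘ A) B) = z≤n
      ... | false | false rewrite line-outside B LB ZB = z≤n

    -- The bound a′ w - a′ (a′ - 1)/2 stops growing near a′ = w, so for large A it is applied to a
    -- subset of chosen size. A line meeting the subset meets A and lies in L or Z.
    few-points : ∀ {a′} → a′ ≤ count A → 2 * (a′ * w) + a′ ≤ 2 * (count Zᴸ + count L) + a′ * a′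
    few-points {a′} a′≤ with p , _ , p⊑A , refl ← interpolate (λ _ → false) A (λ _ ()) a′ (≤-trans (≤-reflexive (sum-zero {v} (λ _ → refl))) z≤n) a′≤ =
      subst (λ s → 2 * (count p * w) + count p ≤ 2 * s + count p * count p) (∑-distrib-+ (χ ∘ Zᴸ) (χ ∘ L))
        (lines-meeting p (λ B → χ (Zᴸ B) + χ (L B)) covers)
      where
      covers : ∀ B → 0 < meet (χ ∘ p) B → 1 ≤ χ (Zᴸ B) + χ (L B)
      covers B 0<m with Zᴸ B in ZB | L B in LB
      ... | true  | _     = s≤s z≤n
      ... | false | true  = ≤-refl
      ... | false | false = contradiction (≤-trans 0<m (≤-trans (meet-mono (λ x → χ-mono (p⊑A x)) B) (≤-reflexive (line-outside B LB ZB)))) λ ()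

    few-lines : ∀ {b′ Q} → b′ + n * w ≡ w * w + w → suc Q ≡ count V + w →
                w * w * count V + Q * count L ≤ Q * b′
    few-lines {b′} {Q} b′≡ Q≡ with refl ← +-cancelʳ-≡ (n * w) b′ b (trans b′≡ (sym line-count)) =
      lines-avoiding V L (≤-pred (≤-trans (≤-trans (s≤s (s≤s z≤n)) 4≤w) (≤-trans (m≤n+m w (count V)) (≤-reflexive (sym Q≡)))))
        line-in-S Q≡

  size≤ : ∀ (S : Subset (v + b)) → 2 * ∣ S ∣ ≤ v + b → 2 * ∣ S ∣ ≤ w * w + w
  size≤ S adm with h , eq ← pronic-even w = subst (2 * ∣ S ∣ ≤_) (sym eq) (*-monoʳ-≤ 2 (2m<2n+2⇒m≤n {∣ S ∣} {h} (begin-strict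
    2 * ∣ S ∣         ≤⟨ adm ⟩
    v + b             ≡⟨ order ⟩
    suc (w * w + w)   ≡⟨ cong suc eq ⟩
    1 + 2 * h         <⟨ n<1+n (1 + 2 * h) ⟩
    2 + 2 * h         ≡⟨ +-comm 2 (2 * h) ⟩
    2 * h + 2         ∎)))
    where open ≤-Reasoning

  floor≤v : ∀ {t} → IsFloorC n t → t ≤ v
  floor≤v {t} floor with d , w≡ , _ ← floor-gap n t floor =
    ≤-trans (≤-trans (m≤m+n t d) (≤-reflexive (sym w≡))) w≤v

  isoperimetric-lower : ∀ {t} → IsFloorC n t → (S : Subset (v + b)) → 2 * ∣ S ∣ ≤ v + b →
                        2 * (v ∸ t) * ∣ S ∣ ≤ ∣ nbhd G S ∣ * (n ^ 2 * (n ^ 2 + 1))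
  isoperimetric-lower {t} floor S adm with d , w≡ , _ , d-upper ← floor-gap n t floor = begin
    2 * (v ∸ t) * ∣ S ∣                       ≡⟨ cong (2 * (v ∸ t) *_) (∣∣-split S) ⟩
    2 * (v ∸ t) * (count A + count L)         ≤⟨ separator-bound n {d = d} 2≤n refl w≡ d-upper (trans (m∸n+n≡m t≤v) v≡) partition-count cross few-points few-lines
                                                   (subst (λ s → 2 * s ≤ w * w + w) (∣∣-split S) (size≤ S adm)) ⟩
    (w * w + w) * (count Z + count Zᴸ)        ≡⟨ *-comm (w * w + w) _ ⟩
    (count Z + count Zᴸ) * (w * w + w)        ≡⟨ cong₂ _*_ (∣∣-split (nbhd G S)) denominator ⟨
    ∣ nbhd G S ∣ * (n ^ 2 * (n ^ 2 + 1))      ∎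
    where
    open ≤-Reasoning
    open Separation S
    t≤v : t ≤ v
    t≤v = floor≤v floor

  -- Arcs completed by lines, and the upper bound

  arc-meet≤2 : ∀ {m} {A : Subset v} → IsArc U m A → ∀ p → p ⊑ lookup A → ∀ B → meet (χ ∘ p) B ≤ 2
  arc-meet≤2 {A = A} (_ , _ , noncollinear) p p⊑A B = ≮⇒≥ λ 2<m →
    collinear (elements (λ x → p x ∧ lookup (block B) x) 3
      (≤-trans 2<m (≤-reflexive (sum-cong-≗ (λ x → sym (χ-∧ (p x) (lookup (block B) x)))))))
    where
    collinear : (∃ λ (f : Fin 3 → Fin v) → (∀ i j → f i ≡ f j → i ≡ j) × (∀ i → p (f i) ∧ lookup (block B) (f i) ≡ true)) → ⊥
    collinear (f , inj , mem) = noncollinear (f i₀) (f i₁) (f i₂) (inA i₀) (inA i₁) (inA i₂)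
      (λ e → case inj i₀ i₁ e of λ ()) (λ e → case inj i₁ i₂ e of λ ()) (λ e → case inj i₀ i₂ e of λ ())
      B (inB i₀ , inB i₁ , inB i₂)
      where
      i₀ i₁ i₂ : Fin 3
      i₀ = zero
      i₁ = suc zero
      i₂ = suc (suc zero)
      inA : ∀ i → f i ∈ A
      inA i = lookup⇒[]= (f i) A (p⊑A (f i) (proj₁ (∧-true (mem i))))
      inB : ∀ i → f i ∈ block B
      inB i = lookup⇒[]= (f i) (block B) (proj₂ (∧-true (mem i)))

  -- The set S gets exactly M = (w² + w)/2 vertices, so |N(S)| ≤ v - x is already the required
  -- ratio. Asking for `meet` at most 2 instead of `IsArc` admits sets of fewer than three points,
  -- as occur for n = 2, where t = 2.
  arc-completion : ∀ p {c d} → (∀ B → meet (χ ∘ p) B ≤ 2) → w ≡ count p + c + d → 2 * w ≤ d * d + 3 * d →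
                   ∃[ S ] Nonempty S × 2 * ∣ S ∣ ≤ v + b ×
                     ∣ nbhd G S ∣ * (n ^ 2 * (n ^ 2 + 1)) ≤ 2 * (v ∸ count p) * ∣ S ∣
  arc-completion p {c} {d} m≤2 w≡ d-lower = build (interpolate q (λ _ → true) (λ _ _ → refl) (M ∸ x) q≤ ≤b)
    where
    M : ℕ
    M = proj₁ (pronic-even w)
    2M≡ : w * w + w ≡ 2 * M
    2M≡ = proj₂ (pronic-even w)
    x : ℕ
    x = count p
    q : Fin b → Bool
    q B = 0 <ᵇ meet (χ ∘ p) B
    q≡0 : ∀ {k} → k ≡ 0 → χ (0 <ᵇ k) ≡ 0
    q≡0 refl = refl
    fits : x + count q ≤ M
    fits = *-cancelˡ-≤ 2 (subst (2 * (x + count q) ≤_) 2M≡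
      (arc-fits {c = c} {d} w≡ d-lower (lines-meeting-arc p (χ ∘ q) m≤2 (χ≤1 ∘ q) (λ B → q≡0))))
    q≤ : count q ≤ M ∸ x
    q≤ = m+n≤o⇒m≤o∸n (count q) (subst (_≤ M) (+-comm x (count q)) fits)
    -- Enough lines for padding: 2n ≤ w gives 2b = 2 (w² + w - n w) ≥ w² + 2w ≥ 2M.
    M≤b : M ≤ b
    M≤b = *-cancelˡ-≤ 2 (≤-certificate w
      (+-mono-≤ (+-mono-≤ (*-monoʳ-≤ 2 (≤-reflexive (sym line-count))) (*-monoˡ-≤ w (*-monoˡ-≤ n 2≤n))) (≤-reflexive (sym 2M≡)))
      (eq M b n w))
      where
      eq : ∀ M b n w → 2 * M + (2 * (b + n * w) + w * w + (w * w + w)) + w ≡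
           2 * b + (2 * (w * w + w) + 2 * n * w + 2 * M)
      eq = solve-∀
    ≤b : M ∸ x ≤ count {b} (λ _ → true)
    ≤b = ≤-trans (m∸n≤m M x) (≤-trans M≤b (≤-reflexive (sym (trans (sum-const b 1) (*-identityʳ b)))))
    build : (∃[ ℓ ] q ⊑ ℓ × ℓ ⊑ (λ _ → true) × count ℓ ≡ M ∸ x) →
            ∃[ S ] Nonempty S × 2 * ∣ S ∣ ≤ v + b ×
              ∣ nbhd G S ∣ * (n ^ 2 * (n ^ 2 + 1)) ≤ 2 * (v ∸ x) * ∣ S ∣
    build (ℓ , q⊑ℓ , _ , ℓ≡) = S , nonempty , size , ratio
      where
      S : Subset (v + b)
      S = tabulate (λ i → [ p , ℓ ]′ (splitAt v i))
      on-points : ∀ y → lookup S (y ↑ˡ b) ≡ p y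
      on-points y = trans (lookup∘tabulate _ (y ↑ˡ b)) (cong [ p , ℓ ]′ (Fin.splitAt-↑ˡ v y b))
      on-lines : ∀ B → lookup S (v ↑ʳ B) ≡ ℓ B
      on-lines B = trans (lookup∘tabulate _ (v ↑ʳ B)) (cong [ p , ℓ ]′ (Fin.splitAt-↑ʳ v b B))
      ∣S∣≡M : ∣ S ∣ ≡ M
      ∣S∣≡M = begin
        ∣ S ∣          ≡⟨ ∣∣-split S ⟩
        count (λ y → lookup S (y ↑ˡ b)) + count (λ B → lookup S (v ↑ʳ B))
                       ≡⟨ cong₂ _+_ (sum-cong-≗ (cong χ ∘ on-points)) (sum-cong-≗ (cong χ ∘ on-lines)) ⟩
        x + count ℓ    ≡⟨ cong (x +_) ℓ≡ ⟩
        x + (M ∸ x)    ≡⟨ m+[n∸m]≡n (m+n≤o⇒m≤o x fits) ⟩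
        M ∎
        where open ≡-Reasoning
      0<M : 0 < M
      0<M = *-cancelˡ-< 2 0 M (subst (0 <_) 2M≡ (≤-trans (≤-trans (s≤s z≤n) 4≤w) (m≤n+m w (w * w))))
      nonempty : Nonempty S
      nonempty with f , _ , mem ← elements (lookup S) 1 (≤-trans 0<M (≤-reflexive (trans (sym ∣S∣≡M) (∣∣≡count S)))) =
        f zero , lookup⇒[]= (f zero) S (mem zero)
      size : 2 * ∣ S ∣ ≤ v + b
      size = begin
        2 * ∣ S ∣       ≡⟨ cong (2 *_) ∣S∣≡M ⟩
        2 * M           ≡⟨ 2M≡ ⟨
        w * w + w       ≤⟨ n≤1+n _ ⟩
        suc (w * w + w) ≡⟨ order ⟨
        v + b ∎
        where open ≤-Reasoning
      no-line : ∀ B → χ (lookup (nbhd G S) (v ↑ʳ B)) ≡ 0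
      no-line B with lookup (nbhd G S) (v ↑ʳ B) in NB
      ... | false = refl
      -- A line of N(S) passes through a point of `p`, hence satisfies `q` and was already put into
      -- S.
      ... | true with ¬SB , y , Sy , yB ← nbhd⁻ G S NB with z , refl , zB ← adj-line⁻ yB =
        case trans (sym (trans (sym (on-lines B)) ¬SB)) (q⊑ℓ B (Equivalence.to T-≡ (<⇒<ᵇ 0<meet))) of λ ()
        where
        0<meet : 0 < meet (χ ∘ p) B
        0<meet = ≤-trans (≤-reflexive (sym (cong₂ (λ s t → χ s * χ t) (trans (sym (on-points z)) Sy) zB)))
                         (term≤sum (λ z → χ (p z) * inc z B) z)
      point : ∀ y → χ (lookup (nbhd G S) (y ↑ˡ b)) + χ (p y) ≤ 1
      point y with lookup (nbhd G S) (y ↑ˡ b) in Ny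
      ... | false = χ≤1 (p y)
      ... | true rewrite trans (sym (on-points y)) (proj₁ (nbhd⁻ G S Ny)) = ≤-refl
      ∣N∣+x≤v : ∣ nbhd G S ∣ + x ≤ v
      ∣N∣+x≤v = begin
        ∣ nbhd G S ∣ + x ≡⟨ cong (_+ x) (∣∣-split (nbhd G S)) ⟩
        count Np + sum (λ B → χ (lookup (nbhd G S) (v ↑ʳ B))) + x ≡⟨ cong (λ s → count Np + s + x) (sum-zero no-line) ⟩
        count Np + 0 + x ≡⟨ cong (_+ x) (+-identityʳ (count Np)) ⟩
        count Np + x     ≡⟨ ∑-distrib-+ (χ ∘ Np) (χ ∘ p) ⟨
        sum (λ y → χ (Np y) + χ (p y)) ≤⟨ sum-mono-≤ point ⟩
        sum {v} (λ _ → 1) ≡⟨ trans (sum-const v 1) (*-identityʳ v) ⟩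
        v ∎
        where
        open ≤-Reasoning
        Np : Fin v → Bool
        Np y = lookup (nbhd G S) (y ↑ˡ b)
      ratio : ∣ nbhd G S ∣ * (n ^ 2 * (n ^ 2 + 1)) ≤ 2 * (v ∸ x) * ∣ S ∣
      ratio = begin
        ∣ nbhd G S ∣ * (n ^ 2 * (n ^ 2 + 1))  ≤⟨ *-mono-≤ {∣ nbhd G S ∣} {v ∸ x} (m+n≤o⇒m≤o∸n ∣ nbhd G S ∣ {x} {v} ∣N∣+x≤v) (≤-reflexive (trans denominator 2M≡)) ⟩
        (v ∸ x) * (2 * M)                     ≡⟨ eq (v ∸ x) M ⟩
        2 * (v ∸ x) * M                       ≡⟨ cong (2 * (v ∸ x) *_) ∣S∣≡M ⟨
        2 * (v ∸ x) * ∣ S ∣ ∎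
        where
        open ≤-Reasoning
        eq : ∀ y M → y * (2 * M) ≡ 2 * y * M
        eq = solve-∀

  isoperimetric-upper : ∀ {m t} {A : Subset v} → IsArc U m A → IsFloorC n t →
                        ∃[ S ] Nonempty S × 2 * ∣ S ∣ ≤ v + b ×
                          ∣ nbhd G S ∣ * (n ^ 2 * (n ^ 2 + 1)) ≤ 2 * (v ∸ (m ⊓ t)) * ∣ S ∣
  isoperimetric-upper {m} {t} {A} arc@(_ , ∣A∣≡m , _) floor = choose subarc (floor-gap n t floor) below
    where
    Goal : ℕ → Set
    Goal x = ∃[ S ] Nonempty S × 2 * ∣ S ∣ ≤ v + b ×
               ∣ nbhd G S ∣ * (n ^ 2 * (n ^ 2 + 1)) ≤ 2 * (v ∸ x) * ∣ S ∣
    subarc : ∃[ p ] (λ _ → false) ⊑ p × p ⊑ lookup A × count p ≡ m ⊓ t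
    subarc = interpolate (λ _ → false) (lookup A) (λ _ ()) (m ⊓ t)
      (≤-trans (≤-reflexive (sum-zero {v} (λ _ → refl))) z≤n)
      (≤-trans (m⊓n≤m m t) (≤-reflexive (trans (sym ∣A∣≡m) (∣∣≡count A))))
    below : ∃[ c ] (m ⊓ t) + c ≡ t
    below = m≤n⇒∃[o]m+o≡n (m⊓n≤n m t)
    choose : (∃[ p ] (λ _ → false) ⊑ p × p ⊑ lookup A × count p ≡ m ⊓ t) →
             (∃[ d ] w ≡ t + d × 2 * w ≤ d * d + 3 * d × d * d + d ≤ 2 * w) →
             (∃[ c ] (m ⊓ t) + c ≡ t) → Goal (m ⊓ t)
    choose (p , _ , p⊑A , p≡) (d , w≡ , d-lower , _) (c , c≡) = subst Goal p≡
      (arc-completion p {c} {d} (arc-meet≤2 arc p p⊑A)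
        (trans w≡ (cong (_+ d) (trans (sym c≡) (cong (_+ c) (sym p≡))))) d-lower)

theorem1p1 : (n : ℕ) → .{{_ : NonZero n}} → 2 ≤ n → (U : Unital n) →
    (m t : ℕ) → IsMaxArcSize U m → IsFloorC n t →
    (i : ℚ) → IsVertexIsoperimetricNumber (incidenceGraph U) i →
    bound n t ℚ.≤ i × i ℚ.≤ bound n (m ⊓ t)
theorem1p1 n 2≤n U m t ((A , arc) , _) floor i ((S , (ne , half) , i≡) , minimal) =
  subst (bound n t ℚ.≤_) (sym i≡) lower , upper (isoperimetric-upper 2≤n U arc floor)
  where
  G : Graph
  G = incidenceGraph U
  t≤v : t ≤ n ^ 3 + 1
  t≤v = floor≤v 2≤n U floor
  lower : bound n t ℚ.≤ isoRatio G S ne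
  lower = bound≤ n ∣ nbhd G S ∣ ∣ S ∣ {{nonempty⇒nonZero S ne}} t≤v (isoperimetric-lower 2≤n U {t} floor S half)
  upper : (∃[ S′ ] Nonempty S′ × 2 * ∣ S′ ∣ ≤ Graph.N G ×
            ∣ nbhd G S′ ∣ * (n ^ 2 * (n ^ 2 + 1)) ≤ 2 * (n ^ 3 + 1 ∸ (m ⊓ t)) * ∣ S′ ∣) → i ℚ.≤ bound n (m ⊓ t)
  upper (S′ , ne′ , half′ , ratio) = ℚ.≤-trans (minimal S′ (ne′ , half′))
    (≤bound n ∣ nbhd G S′ ∣ ∣ S′ ∣ {{nonempty⇒nonZero S′ ne′}} (≤-trans (m⊓n≤n m t) t≤v) ratio)
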